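{- Let $\mathcal{C}$ be a topos, $F:\mathcal{C}\to\mathcal{C}$ an endofunctor that preserves weak pullbacks, and $\leq$ a good order structure on $F$. Then the following is a locally ordered 2-category: \begin{itemize} \item objects are $F$-coalgebras; \item morphisms from $\alpha:X\to FX$ to $\beta:Y\to FY$ are the relations from $X$ to $Y$ that are toposal AM-simulations from $\alpha$ to $\beta$; \item identities, composition and the order $\sqsubseteq$ on morphisms are those of $\mathbf{Rel}(\mathcal{C})$. \end{itemize}
   Context: A topos is a finitely complete category with power-objects: for every object $X$ there are an object $\mathcal{P}X$ and a mono $\in_X:E_X\rightarrowtail X\times\mathcal{P}X$ such that for every mono $m:R\rightarrowtail X\times Y$ there is a unique morphism $\xi_m:Y\to\mathcal{P}X$ such that $m$ is a pullback of $\in_X$ along $\mathrm{id}_X\times\xi_m$. $\mathcal{P}$ is the covariant functor given on $f:X\to Y$ by $\mathcal{P}f=\xi_{m_f}$, where $m_f$ is the mono part of the (epi, mono)-factorisation of $(f\times\mathrm{id})\cdot\in_X:E_X\to Y\times\mathcal{P}X$, and $\eta_X=\xi_{\langle\mathrm{id},\mathrm{id}\rangle}:X\to\mathcal{P}X$ (the unit of the power-object monad). A weak pullback of a cospan is a commutative square over it through which every other commutative square over it factors, not necessarily uniquely. $\mathbf{Rel}(\mathcal{C})$ has the objects of $\mathcal{C}$; morphisms from $X$ to $Y$ are relations, i.e. subobjects of $X\times Y$, ordered by $\sqsubseteq$ (factorisation of representing monos). The identity on $X$ is represented by $\langle\mathrm{id},\mathrm{id}\rangle:X\rightarrowtail X\times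 X$. The composite $r;s$ of $r$ (represented by $m_r:R\rightarrowtail X\times Y$) and $s$ (represented by $m_s:S\rightarrowtail Y\times Z$) is represented by the mono part of the (epi, mono)-factorisation of $\langle \pi_1\cdot m_r\cdot\mu_1,\pi_2\cdot m_s\cdot\mu_2\rangle:R\star S\to X\times Z$, where $(R\star S,\mu_1,\mu_2)$ is the pullback of $\pi_2\cdot m_r$ and $\pi_1\cdot m_s$ over $Y$. A good order structure on an endofunctor $F$ is a preorder $\leq$ on each Hom-set of the form $\mathcal{C}(X,FY)$ such that: (1) if $\alpha\leq\beta$ in $\mathcal{C}(X,FY)$, $f:X'\to X$ and $g:Y\to Y'$, then $Fg\cdot\alpha\cdot f\leq Fg\cdot\beta\cdot f$ in $\mathcal{C}(X',FY')$; (2) if $h:X\to FZ$, $k:X\to FY$, $g:Y\to Z$ and $h\leq Fg\cdot k$ in $\mathcal{C}(X,FZ)$, then there is $k':X\to FY$ such that $k'\leq k$ in $\mathcal{C}(X,FY)$ and $h=Fg\cdot k'$. The relation $\leq_{\mathcal{P}}$ on $\mathcal{C}(X,\mathcal{P}FY)$: every $f:X\to\mathcal{P}FY$ corresponds to a mono $m_f:U_f\rightarrowtail FY\times X$, unique up to isomorphism, with $f=\xi_{m_f}$. For $f,g:X\to\mathcal{P}FY$, $f\leq_{\mathcal{P}}g$ if there exist a morphism $u:Z\to U_g$ and an epi $e:Z\to U_f$ such that $\pi_1\cdot m_f\cdot e\leq\pi_1\cdot m_g\cdot u$ and $\pi_2\cdot m_f\cdot e=\pi_2\cdot m_g\cdot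 u$. An $F$-coalgebra is a morphism $\alpha:X\to FX$. Toposal AM-simulation: a relation from $X$ to $Y$ is a toposal AM-simulation from $\alpha:X\to FX$ to $\beta:Y\to FY$ if for any mono $r:R\rightarrowtail X\times Y$ representing it there is a morphism $W:R\to\mathcal{P}FR$ such that $$\eta_{FX}\cdot\alpha\cdot\pi_1\cdot r\leq_{\mathcal{P}}\mathcal{P}F\pi_1\cdot\mathcal{P}Fr\cdot W\quad\text{and}\quad \mathcal{P}F\pi_2\cdot\mathcal{P}Fr\cdot W\leq_{\mathcal{P}}\eta_{FY}\cdot\beta\cdot\pi_2\cdot r .$$ -}

module Defs where

open import Level using (Level; _⊔_; suc)
open import Data.Product using (Σ; Σ-syntax; ∃; ∃-syntax; _,_; proj₁; proj₂)
  renaming (_×_ to _∧_)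
open import Relation.Binary.Core using (Rel)
open import Relation.Binary.Bundles using (Setoid)
open import Relation.Binary.Structures using (IsEquivalence; IsPreorder; IsPartialOrder)
import Relation.Binary.Reasoning.Setoid as SetoidReasoning

-- Hom-sets are setoids: `_≈_` is equality of morphisms, and there is no
-- equality of objects.
record Category (o ℓ e : Level) : Set (suc (o ⊔ ℓ ⊔ e)) where
  infix  4 _≈_ _⇒_
  infixr 9 _∘_
  field
    Obj       : Set o
    _⇒_       : Obj → Obj → Set ℓ
    _≈_       : ∀ {A B} → Rel (A ⇒ B) e
    id        : ∀ {A} → A ⇒ A
    _∘_       : ∀ {A B C} → B ⇒ C → A ⇒ B → A ⇒ C
    equiv     : ∀ {A B} → IsEquivalence (_≈_ {A} {B})
    assoc     : ∀ {A B C D} {f : A ⇒ B} {g : B ⇒ C} {h : C ⇒ D} →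
                (h ∘ g) ∘ f ≈ h ∘ (g ∘ f)
    identityˡ : ∀ {A B} {f : A ⇒ B} → id ∘ f ≈ f
    identityʳ : ∀ {A B} {f : A ⇒ B} → f ∘ id ≈ f
    ∘-resp-≈  : ∀ {A B C} {f h : B ⇒ C} {g i : A ⇒ B} →
                f ≈ h → g ≈ i → f ∘ g ≈ h ∘ i

  module Equiv {A B : Obj} = IsEquivalence (equiv {A} {B})

  hom-setoid : ∀ {A B} → Setoid ℓ e
  hom-setoid {A} {B} = record { Carrier = A ⇒ B ; _≈_ = _≈_ ; isEquivalence = equiv }

  module HomReasoning {A B : Obj} = SetoidReasoning (hom-setoid {A} {B})

  Mono : ∀ {A B} → A ⇒ B → Set (o ⊔ ℓ ⊔ e)
  Mono {A} f = ∀ {Z} (g h : Z ⇒ A) → f ∘ g ≈ f ∘ h → g ≈ h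

  Epi : ∀ {A B} → A ⇒ B → Set (o ⊔ ℓ ⊔ e)
  Epi {_} {B} f = ∀ {Z} (g h : B ⇒ Z) → g ∘ f ≈ h ∘ f → g ≈ h

  -- The squares below have the shape
  --
  --        p₂
  --     P ----> B
  --   p₁|       | g
  --     v       v
  --     A ----> D
  --        f

  record IsWeakPullback {P A B D} (p₁ : P ⇒ A) (p₂ : P ⇒ B) (f : A ⇒ D) (g : B ⇒ D)
                        : Set (o ⊔ ℓ ⊔ e) where
    field
      commute : f ∘ p₁ ≈ g ∘ p₂
      factor  : ∀ {Q} (h₁ : Q ⇒ A) (h₂ : Q ⇒ B) → f ∘ h₁ ≈ g ∘ h₂ →
                ∃[ u ] (p₁ ∘ u ≈ h₁) ∧ (p₂ ∘ u ≈ h₂)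

  record IsPullback {P A B D} (p₁ : P ⇒ A) (p₂ : P ⇒ B) (f : A ⇒ D) (g : B ⇒ D)
                    : Set (o ⊔ ℓ ⊔ e) where
    field
      commute   : f ∘ p₁ ≈ g ∘ p₂
      universal : ∀ {Q} (h₁ : Q ⇒ A) (h₂ : Q ⇒ B) → f ∘ h₁ ≈ g ∘ h₂ → Q ⇒ P
      p₁∘universal : ∀ {Q} {h₁ : Q ⇒ A} {h₂ : Q ⇒ B} {eq : f ∘ h₁ ≈ g ∘ h₂} →
                     p₁ ∘ universal h₁ h₂ eq ≈ h₁
      p₂∘universal : ∀ {Q} {h₁ : Q ⇒ A} {h₂ : Q ⇒ B} {eq : f ∘ h₁ ≈ g ∘ h₂} →
                     p₂ ∘ universal h₁ h₂ eq ≈ h₂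
      unique    : ∀ {Q} (u v : Q ⇒ P) → p₁ ∘ u ≈ p₁ ∘ v → p₂ ∘ u ≈ p₂ ∘ v → u ≈ v

  -- `m` is a pullback of `n` along `f`.
  IsPullbackOfAlong : ∀ {P A B D} (m : P ⇒ A) (n : B ⇒ D) (f : A ⇒ D) → Set (o ⊔ ℓ ⊔ e)
  IsPullbackOfAlong {P} {_} {B} m n f = Σ[ t ∈ P ⇒ B ] IsPullback m t f n

  record Pullback {A B D} (f : A ⇒ D) (g : B ⇒ D) : Set (o ⊔ ℓ ⊔ e) where
    field
      P          : Obj
      p₁         : P ⇒ A
      p₂         : P ⇒ B
      isPullback : IsPullback p₁ p₂ f g
    open IsPullback isPullback public

  record EpiMonoFactorisation {A B} (f : A ⇒ B) : Set (o ⊔ ℓ ⊔ e) where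
    field
      Im      : Obj
      epi     : A ⇒ Im
      mono    : Im ⇒ B
      isEpi   : Epi epi
      isMono  : Mono mono
      commute : mono ∘ epi ≈ f

record FinitelyComplete {o ℓ e} (C : Category o ℓ e) : Set (o ⊔ ℓ ⊔ e) where
  open Category C
  infixr 7 _×_ _×₁_
  field
    ⊤        : Obj
    !        : ∀ {A} → A ⇒ ⊤
    !-unique : ∀ {A} (f g : A ⇒ ⊤) → f ≈ g

    _×_      : Obj → Obj → Obj
    π₁       : ∀ {A B} → A × B ⇒ A
    π₂       : ∀ {A B} → A × B ⇒ B
    ⟨_,_⟩    : ∀ {A B Z} → Z ⇒ A → Z ⇒ B → Z ⇒ A × B
    project₁ : ∀ {A B Z} {f : Z ⇒ A} {g : Z ⇒ B} → π₁ ∘ ⟨ f , g ⟩ ≈ f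
    project₂ : ∀ {A B Z} {f : Z ⇒ A} {g : Z ⇒ B} → π₂ ∘ ⟨ f , g ⟩ ≈ g
    ×-unique : ∀ {A B Z} (u v : Z ⇒ A × B) → π₁ ∘ u ≈ π₁ ∘ v → π₂ ∘ u ≈ π₂ ∘ v → u ≈ v

    pullback : ∀ {A B D} (f : A ⇒ D) (g : B ⇒ D) → Pullback f g

  _×₁_ : ∀ {A B A′ B′} → A ⇒ A′ → B ⇒ B′ → A × B ⇒ A′ × B′
  f ×₁ g = ⟨ f ∘ π₁ , g ∘ π₂ ⟩

record Topos (o ℓ e : Level) : Set (suc (o ⊔ ℓ ⊔ e)) where
  field
    category         : Category o ℓ e
    finitelyComplete : FinitelyComplete category
  open Category category public
  open FinitelyComplete finitelyComplete public
  field
    𝒫        : Obj → Obj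
    E        : Obj → Obj
    ∈        : ∀ X → E X ⇒ X × 𝒫 X
    ∈-mono   : ∀ {X} → Mono (∈ X)
    ξ        : ∀ {X Y R} (m : R ⇒ X × Y) → Mono m → Y ⇒ 𝒫 X
    ξ-pb     : ∀ {X Y R} (m : R ⇒ X × Y) (mono : Mono m) →
               IsPullbackOfAlong m (∈ X) (id ×₁ ξ m mono)
    ξ-unique : ∀ {X Y R} (m : R ⇒ X × Y) (mono : Mono m) (h : Y ⇒ 𝒫 X) →
               IsPullbackOfAlong m (∈ X) (id ×₁ h) → h ≈ ξ m mono

module ToposDefs {o ℓ e} (T : Topos o ℓ e) where
  open Topos T

  module Basics where
    open HomReasoning

    id-mono : ∀ {A} → Mono (id {A})
    id-mono g h eq = Equiv.trans (Equiv.sym identityˡ) (Equiv.trans eq identityˡ)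

    ∘-congˡ : ∀ {A B D} {f : B ⇒ D} {g h : A ⇒ B} → g ≈ h → f ∘ g ≈ f ∘ h
    ∘-congˡ = ∘-resp-≈ Equiv.refl

    ∘-congʳ : ∀ {A B D} {f g : B ⇒ D} {h : A ⇒ B} → f ≈ g → f ∘ h ≈ g ∘ h
    ∘-congʳ eq = ∘-resp-≈ eq Equiv.refl

    pull : ∀ {A B D G} {f : D ⇒ G} {g : B ⇒ D} {h : A ⇒ B} {k : B ⇒ G} →
           f ∘ g ≈ k → f ∘ (g ∘ h) ≈ k ∘ h
    pull eq = Equiv.trans (Equiv.sym assoc) (∘-congʳ eq)

    ⟨⟩∘ : ∀ {A B Y Z} {f : Z ⇒ A} {g : Z ⇒ B} {h : Y ⇒ Z} →
          ⟨ f , g ⟩ ∘ h ≈ ⟨ f ∘ h , g ∘ h ⟩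
    ⟨⟩∘ = ×-unique _ _
      (Equiv.trans (pull project₁) (Equiv.sym project₁))
      (Equiv.trans (pull project₂) (Equiv.sym project₂))

    ⟨⟩-cong : ∀ {A B Z} {f f′ : Z ⇒ A} {g g′ : Z ⇒ B} →
              f ≈ f′ → g ≈ g′ → ⟨ f , g ⟩ ≈ ⟨ f′ , g′ ⟩
    ⟨⟩-cong p q = ×-unique _ _
      (Equiv.trans project₁ (Equiv.trans p (Equiv.sym project₁)))
      (Equiv.trans project₂ (Equiv.trans q (Equiv.sym project₂)))

    ×₁∘⟨⟩ : ∀ {A B A′ B′ Z} {f : A ⇒ A′} {g : B ⇒ B′} {h : Z ⇒ A} {k : Z ⇒ B} →
            (f ×₁ g) ∘ ⟨ h , k ⟩ ≈ ⟨ f ∘ h , g ∘ k ⟩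
    ×₁∘⟨⟩ = Equiv.trans ⟨⟩∘ (⟨⟩-cong
      (Equiv.trans assoc (∘-congˡ project₁))
      (Equiv.trans assoc (∘-congˡ project₂)))

    id×-∘ : ∀ {X A B D} {g : B ⇒ D} {h : A ⇒ B} →
            (id {X} ×₁ g) ∘ (id ×₁ h) ≈ id ×₁ (g ∘ h)
    id×-∘ = Equiv.trans ×₁∘⟨⟩ (⟨⟩-cong identityˡ (Equiv.sym assoc))

    pb-mono : ∀ {P A B D} {p₁ : P ⇒ A} {p₂ : P ⇒ B} {f : A ⇒ D} {g : B ⇒ D} →
              IsPullback p₁ p₂ f g → Mono g → Mono p₁
    pb-mono {p₁ = p₁} {p₂} {f} {g} pb g-mono u v eq = unique u v eq
      (g-mono _ _ (begin
        g ∘ (p₂ ∘ u) ≈⟨ pull (Equiv.sym commute) ⟩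
        (f ∘ p₁) ∘ u ≈⟨ assoc ⟩
        f ∘ (p₁ ∘ u) ≈⟨ ∘-congˡ eq ⟩
        f ∘ (p₁ ∘ v) ≈⟨ pull commute ⟩
        (g ∘ p₂) ∘ v ≈⟨ assoc ⟩
        g ∘ (p₂ ∘ v) ∎))
      where open IsPullback pb

  open Basics

  -- The mono m_f corresponding to f : Y → 𝒫X; it satisfies f = ξ m_f.
  module _ {X Y} (f : Y ⇒ 𝒫 X) where
    private module pb = Pullback (pullback (id ×₁ f) (∈ X))

    U⟨_⟩ : Obj
    U⟨_⟩ = pb.P

    m⟨_⟩ : U⟨_⟩ ⇒ X × Y
    m⟨_⟩ = pb.p₁

    m⟨⟩-mono : Mono m⟨_⟩
    m⟨⟩-mono = pb-mono pb.isPullback ∈-mono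

    ξ-m⟨⟩ : f ≈ ξ m⟨_⟩ m⟨⟩-mono
    ξ-m⟨⟩ = ξ-unique m⟨_⟩ m⟨⟩-mono f (pb.p₂ , pb.isPullback)

  record Equaliser {A B} (f g : A ⇒ B) : Set (o ⊔ ℓ ⊔ e) where
    field
      {Eq}  : Obj
      arr   : Eq ⇒ A
      mono  : Mono arr
      equal : f ∘ arr ≈ g ∘ arr
      lift  : ∀ {Z} (h : Z ⇒ A) → f ∘ h ≈ g ∘ h → ∃[ u ] arr ∘ u ≈ h

  module MkEqualiser {A B} (f g : A ⇒ B) where
    open HomReasoning
    private module pb = Pullback (pullback ⟨ f , g ⟩ ⟨ id , id ⟩)

    Eq : Obj
    Eq = pb.P

    arr : Eq ⇒ A
    arr = pb.p₁

    mono : Mono arr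
    mono = pb-mono pb.isPullback λ u v eq → Equiv.trans (Equiv.sym (split u))
      (Equiv.trans (∘-congˡ eq) (split v))
      where
      split : ∀ {Z} (u : Z ⇒ B) → π₁ ∘ (⟨ id , id ⟩ ∘ u) ≈ u
      split u = Equiv.trans (pull project₁) identityˡ

    equal : f ∘ arr ≈ g ∘ arr
    equal = begin
      f ∘ arr                      ≈⟨ project₁ ⟨
      π₁ ∘ ⟨ f ∘ arr , g ∘ arr ⟩   ≈⟨ ∘-congˡ square ⟩
      π₁ ∘ ⟨ pb.p₂ , pb.p₂ ⟩       ≈⟨ project₁ ⟩
      pb.p₂                        ≈⟨ project₂ ⟨
      π₂ ∘ ⟨ pb.p₂ , pb.p₂ ⟩       ≈⟨ ∘-congˡ square ⟨
      π₂ ∘ ⟨ f ∘ arr , g ∘ arr ⟩   ≈⟨ project₂ ⟩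
      g ∘ arr                      ∎
      where
      square : ⟨ f ∘ arr , g ∘ arr ⟩ ≈ ⟨ pb.p₂ , pb.p₂ ⟩
      square = begin
        ⟨ f ∘ arr , g ∘ arr ⟩            ≈⟨ ⟨⟩∘ ⟨
        ⟨ f , g ⟩ ∘ arr                  ≈⟨ pb.commute ⟩
        ⟨ id , id ⟩ ∘ pb.p₂              ≈⟨ ⟨⟩∘ ⟩
        ⟨ id ∘ pb.p₂ , id ∘ pb.p₂ ⟩      ≈⟨ ⟨⟩-cong identityˡ identityˡ ⟩
        ⟨ pb.p₂ , pb.p₂ ⟩                ∎

    lift : ∀ {Z} (h : Z ⇒ A) → f ∘ h ≈ g ∘ h → ∃[ u ] arr ∘ u ≈ h
    lift h eq = pb.universal h (f ∘ h) square , pb.p₁∘universal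
      where
      square : ⟨ f , g ⟩ ∘ h ≈ ⟨ id , id ⟩ ∘ (f ∘ h)
      square = begin
        ⟨ f , g ⟩ ∘ h                     ≈⟨ ⟨⟩∘ ⟩
        ⟨ f ∘ h , g ∘ h ⟩                 ≈⟨ ⟨⟩-cong identityˡ
                                              (Equiv.trans identityˡ eq) ⟨
        ⟨ id ∘ (f ∘ h) , id ∘ (f ∘ h) ⟩   ≈⟨ ⟨⟩∘ ⟨
        ⟨ id , id ⟩ ∘ (f ∘ h)             ∎

  opaque
    equaliser : ∀ {A B} (f g : A ⇒ B) → Equaliser f g
    equaliser f g = record { arr = arr ; mono = mono ; equal = equal ; lift = lift }
      where open MkEqualiser f g

  -- For a mono m : R ↣ X × Y, the part of Y where {x | (x , y) ∈ R} is all of X.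
  record Forall {X Y R} (m : R ⇒ X × Y) : Set (o ⊔ ℓ ⊔ e) where
    field
      {∀R}     : Obj
      arr      : ∀R ⇒ Y
      mono     : Mono arr
      lift     : ∀ {Z} (h : Z ⇒ Y) (k : X × Z ⇒ R) → m ∘ k ≈ id ×₁ h →
                 ∃[ u ] arr ∘ u ≈ h
      total-on : ∃[ k ] m ∘ k ≈ id ×₁ arr

  module MkForall {X Y R} (m : R ⇒ X × Y) (m-mono : Mono m) where
    open HomReasoning
    private
      module m = IsPullback (proj₂ (ξ-pb m m-mono))
      module ⊤pb = IsPullback (proj₂ (ξ-pb (id {X × Y}) id-mono))
      tₘ = proj₁ (ξ-pb m m-mono)
      t⊤ = proj₁ (ξ-pb (id {X × Y}) id-mono)

    ξm ξ⊤ : Y ⇒ 𝒫 X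
    ξm = ξ m m-mono
    ξ⊤ = ξ id id-mono

    open Equaliser (equaliser ξm ξ⊤) public using (arr; mono; equal) renaming (lift to eq-lift)

    private
      total : ∀ {Z} (h : Z ⇒ 𝒫 X) (k : X × Z ⇒ E X) → ∈ X ∘ k ≈ id ×₁ h →
              h ≈ ξ (id {X × Z}) id-mono
      total h k eq = ξ-unique id id-mono h (k , record
        { commute      = Equiv.trans identityʳ (Equiv.sym eq)
        ; universal    = λ h₁ _ _ → h₁
        ; p₁∘universal = identityˡ
        ; p₂∘universal = λ {_} {h₁} {h₂} {sq} → ∈-mono _ _
            (Equiv.trans (pull eq) sq)
        ; unique       = λ u v p _ → id-mono u v p
        })

    lift : ∀ {Z} (h : Z ⇒ Y) (k : X × Z ⇒ R) → m ∘ k ≈ id ×₁ h →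
           ∃[ u ] arr ∘ u ≈ h
    lift h k eq = eq-lift h (Equiv.trans
      (total (ξm ∘ h) (tₘ ∘ k) (begin
        ∈ X ∘ (tₘ ∘ k)            ≈⟨ pull (Equiv.sym m.commute) ⟩
        ((id ×₁ ξm) ∘ m) ∘ k      ≈⟨ assoc ⟩
        (id ×₁ ξm) ∘ (m ∘ k)      ≈⟨ ∘-congˡ eq ⟩
        (id ×₁ ξm) ∘ (id ×₁ h)    ≈⟨ id×-∘ ⟩
        id ×₁ (ξm ∘ h)            ∎))
      (Equiv.sym (total (ξ⊤ ∘ h) (t⊤ ∘ (id ×₁ h)) (begin
        ∈ X ∘ (t⊤ ∘ (id ×₁ h))       ≈⟨ pull (Equiv.sym ⊤pb.commute) ⟩
        ((id ×₁ ξ⊤) ∘ id) ∘ (id ×₁ h) ≈⟨ ∘-congʳ identityʳ ⟩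
        (id ×₁ ξ⊤) ∘ (id ×₁ h)       ≈⟨ id×-∘ ⟩
        id ×₁ (ξ⊤ ∘ h)               ∎))))

    total-on : ∃[ k ] m ∘ k ≈ id ×₁ arr
    total-on = m.universal (id ×₁ arr) (t⊤ ∘ (id ×₁ arr)) (begin
        (id ×₁ ξm) ∘ (id ×₁ arr)        ≈⟨ id×-∘ ⟩
        id ×₁ (ξm ∘ arr)                ≈⟨ ⟨⟩-cong Equiv.refl (∘-congʳ equal) ⟩
        id ×₁ (ξ⊤ ∘ arr)                ≈⟨ id×-∘ ⟨
        (id ×₁ ξ⊤) ∘ (id ×₁ arr)        ≈⟨ ∘-congʳ identityʳ ⟨
        ((id ×₁ ξ⊤) ∘ id) ∘ (id ×₁ arr) ≈⟨ ∘-congʳ ⊤pb.commute ⟩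
        (∈ X ∘ t⊤) ∘ (id ×₁ arr)        ≈⟨ assoc ⟩
        ∈ X ∘ (t⊤ ∘ (id ×₁ arr))        ∎)
      , m.p₁∘universal

  opaque
    forall-part : ∀ {X Y R} (m : R ⇒ X × Y) → Mono m → Forall m
    forall-part m m-mono = record { arr = arr ; mono = mono ; lift = lift ; total-on = total-on }
      where open MkForall m m-mono

  -- The image of f : X → Y as the intersection of the subobjects of Y through
  -- which f factors:
  --   S = {U ∈ 𝒫Y | ∀ x ∈ X. f x ∈ U},   I = {y ∈ Y | ∀ U ∈ S. y ∈ U}.
  module Image {X Y} (f : X ⇒ Y)
               (R : Pullback (f ×₁ id) (∈ Y))
               (S : Forall (Pullback.p₁ R))
               (Q : Pullback ⟨ π₂ , Forall.arr S ∘ π₁ ⟩ (∈ Y))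
               (I : Forall (Pullback.p₁ Q)) where
    open HomReasoning
    module R = Pullback R
    module S = Forall S
    module Q = Pullback Q
    module I = Forall I

    x∈S : X × S.∀R ⇒ E Y
    x∈S = R.p₂ ∘ proj₁ S.total-on

    x∈S-eq : ∈ Y ∘ x∈S ≈ ⟨ f ∘ π₁ , S.arr ∘ π₂ ⟩
    x∈S-eq = begin
      ∈ Y ∘ (R.p₂ ∘ k)                      ≈⟨ pull (Equiv.sym R.commute) ⟩
      ((f ×₁ id) ∘ R.p₁) ∘ k                ≈⟨ assoc ⟩
      (f ×₁ id) ∘ (R.p₁ ∘ k)                ≈⟨ ∘-congˡ (proj₂ S.total-on) ⟩
      (f ×₁ id) ∘ (id ×₁ S.arr)             ≈⟨ ×₁∘⟨⟩ ⟩
      ⟨ f ∘ (id ∘ π₁) , id ∘ (S.arr ∘ π₂) ⟩ ≈⟨ ⟨⟩-cong (∘-congˡ identityˡ) identityˡ ⟩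
      ⟨ f ∘ π₁ , S.arr ∘ π₂ ⟩               ∎
      where k = proj₁ S.total-on

    factor : ∃[ u ] I.arr ∘ u ≈ f
    factor = I.lift f
      (Q.universal (id ×₁ f) (x∈S ∘ ⟨ π₂ , π₁ ⟩) (begin
        ⟨ π₂ , S.arr ∘ π₁ ⟩ ∘ (id ×₁ f)
          ≈⟨ ⟨⟩∘ ⟩
        ⟨ π₂ ∘ (id ×₁ f) , (S.arr ∘ π₁) ∘ (id ×₁ f) ⟩
          ≈⟨ ⟨⟩-cong project₂ (Equiv.trans assoc (∘-congˡ (Equiv.trans project₁ identityˡ))) ⟩
        ⟨ f ∘ π₂ , S.arr ∘ π₁ ⟩
          ≈⟨ ⟨⟩-cong (Equiv.trans assoc (∘-congˡ project₁))
                     (Equiv.trans assoc (∘-congˡ project₂)) ⟨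
        ⟨ (f ∘ π₁) ∘ ⟨ π₂ , π₁ ⟩ , (S.arr ∘ π₂) ∘ ⟨ π₂ , π₁ ⟩ ⟩
          ≈⟨ ⟨⟩∘ ⟨
        ⟨ f ∘ π₁ , S.arr ∘ π₂ ⟩ ∘ ⟨ π₂ , π₁ ⟩
          ≈⟨ pull x∈S-eq ⟨
        ∈ Y ∘ (x∈S ∘ ⟨ π₂ , π₁ ⟩) ∎))
      Q.p₁∘universal

    y∈S : S.∀R × I.∀R ⇒ E Y
    y∈S = Q.p₂ ∘ proj₁ I.total-on

    y∈S-eq : ∈ Y ∘ y∈S ≈ ⟨ I.arr ∘ π₂ , S.arr ∘ π₁ ⟩
    y∈S-eq = begin
      ∈ Y ∘ (Q.p₂ ∘ k)                     ≈⟨ pull (Equiv.sym Q.commute) ⟩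
      (⟨ π₂ , S.arr ∘ π₁ ⟩ ∘ Q.p₁) ∘ k     ≈⟨ assoc ⟩
      ⟨ π₂ , S.arr ∘ π₁ ⟩ ∘ (Q.p₁ ∘ k)     ≈⟨ ∘-congˡ (proj₂ I.total-on) ⟩
      ⟨ π₂ , S.arr ∘ π₁ ⟩ ∘ (id ×₁ I.arr)  ≈⟨ ⟨⟩∘ ⟩
      ⟨ π₂ ∘ (id ×₁ I.arr) , (S.arr ∘ π₁) ∘ (id ×₁ I.arr) ⟩
        ≈⟨ ⟨⟩-cong project₂ (Equiv.trans assoc (∘-congˡ (Equiv.trans project₁ identityˡ))) ⟩
      ⟨ I.arr ∘ π₂ , S.arr ∘ π₁ ⟩          ∎
      where k = proj₁ I.total-on

    I⊆U : (c : ⊤ ⇒ 𝒫 Y) (c′ : ⊤ ⇒ S.∀R) → S.arr ∘ c′ ≈ c →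
          ∃[ k ] ∈ Y ∘ k ≈ ⟨ I.arr , c ∘ ! ⟩
    I⊆U c c′ eq = y∈S ∘ j , (begin
      ∈ Y ∘ (y∈S ∘ j)
        ≈⟨ pull y∈S-eq ⟩
      ⟨ I.arr ∘ π₂ , S.arr ∘ π₁ ⟩ ∘ j
        ≈⟨ ⟨⟩∘ ⟩
      ⟨ (I.arr ∘ π₂) ∘ j , (S.arr ∘ π₁) ∘ j ⟩
        ≈⟨ ⟨⟩-cong (Equiv.trans assoc (∘-congˡ project₂))
                   (Equiv.trans assoc (∘-congˡ project₁)) ⟩
      ⟨ I.arr ∘ id , S.arr ∘ (c′ ∘ !) ⟩
        ≈⟨ ⟨⟩-cong identityʳ (pull eq) ⟩
      ⟨ I.arr , c ∘ ! ⟩ ∎)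
      where
      j : I.∀R ⇒ S.∀R × I.∀R
      j = ⟨ c′ ∘ ! , id ⟩

    U∈S : (c : ⊤ ⇒ 𝒫 Y) (k : X × ⊤ ⇒ E Y) → ∈ Y ∘ k ≈ ⟨ f ∘ π₁ , c ∘ π₂ ⟩ →
          ∃[ c′ ] S.arr ∘ c′ ≈ c
    U∈S c k eq = S.lift c
      (R.universal (id ×₁ c) k (begin
        (f ×₁ id) ∘ (id ×₁ c)             ≈⟨ ×₁∘⟨⟩ ⟩
        ⟨ f ∘ (id ∘ π₁) , id ∘ (c ∘ π₂) ⟩ ≈⟨ ⟨⟩-cong (∘-congˡ identityˡ) identityˡ ⟩
        ⟨ f ∘ π₁ , c ∘ π₂ ⟩               ≈⟨ eq ⟨
        ∈ Y ∘ k                           ∎))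
      R.p₁∘universal

    smallest : ∀ {N} (n : N ⇒ Y) → Mono n → (u : X ⇒ N) → n ∘ u ≈ f →
               ∃[ k ] n ∘ k ≈ I.arr
    smallest {N} n n-mono u nu≈f =
      let c′ , c′-eq = U∈S c (t ∘ (u ∘ π₁)) (Equiv.sym f∈c)
          k , k-eq   = I⊆U c c′ c′-eq
      in below k k-eq
      where
      m : N ⇒ Y × ⊤
      m = ⟨ n , ! ⟩

      m-mono : Mono m
      m-mono g h eq = n-mono g h (begin
        n ∘ g          ≈⟨ pull project₁ ⟨
        π₁ ∘ (m ∘ g)   ≈⟨ ∘-congˡ eq ⟩
        π₁ ∘ (m ∘ h)   ≈⟨ pull project₁ ⟩
        n ∘ h          ∎)

      module m = IsPullback (proj₂ (ξ-pb m m-mono))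
      t = proj₁ (ξ-pb m m-mono)

      c : ⊤ ⇒ 𝒫 Y
      c = ξ m m-mono

      f∈c : ⟨ f ∘ π₁ , c ∘ π₂ ⟩ ≈ ∈ Y ∘ (t ∘ (u ∘ π₁))
      f∈c = begin
        ⟨ f ∘ π₁ , c ∘ π₂ ⟩
          ≈⟨ ⟨⟩-cong (Equiv.trans identityˡ (pull nu≈f)) (∘-congˡ (!-unique _ _)) ⟨
        ⟨ id ∘ (n ∘ (u ∘ π₁)) , c ∘ (! ∘ (u ∘ π₁)) ⟩
          ≈⟨ ×₁∘⟨⟩ ⟨
        (id ×₁ c) ∘ ⟨ n ∘ (u ∘ π₁) , ! ∘ (u ∘ π₁) ⟩
          ≈⟨ ∘-congˡ ⟨⟩∘ ⟨
        (id ×₁ c) ∘ (m ∘ (u ∘ π₁))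
          ≈⟨ pull m.commute ⟩
        (∈ Y ∘ t) ∘ (u ∘ π₁)
          ≈⟨ assoc ⟩
        ∈ Y ∘ (t ∘ (u ∘ π₁)) ∎

      below : (k : I.∀R ⇒ E Y) → ∈ Y ∘ k ≈ ⟨ I.arr , c ∘ ! ⟩ → ∃[ v ] n ∘ v ≈ I.arr
      below k k-eq = v , (begin
        n ∘ v               ≈⟨ pull project₁ ⟨
        π₁ ∘ (m ∘ v)        ≈⟨ ∘-congˡ m.p₁∘universal ⟩
        π₁ ∘ ⟨ I.arr , ! ⟩  ≈⟨ project₁ ⟩
        I.arr               ∎)
        where
        v = m.universal ⟨ I.arr , ! ⟩ k (begin
          (id ×₁ c) ∘ ⟨ I.arr , ! ⟩  ≈⟨ ×₁∘⟨⟩ ⟩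
          ⟨ id ∘ I.arr , c ∘ ! ⟩     ≈⟨ ⟨⟩-cong identityˡ Equiv.refl ⟩
          ⟨ I.arr , c ∘ ! ⟩          ≈⟨ k-eq ⟨
          ∈ Y ∘ k                    ∎)

    epi : Epi (proj₁ factor)
    epi {Z} g h eq = begin
      g                  ≈⟨ identityʳ ⟨
      g ∘ id             ≈⟨ ∘-congˡ nk≈id ⟨
      g ∘ (G.arr ∘ k)    ≈⟨ pull G.equal ⟩
      (h ∘ G.arr) ∘ k    ≈⟨ assoc ⟩
      h ∘ (G.arr ∘ k)    ≈⟨ ∘-congˡ nk≈id ⟩
      h ∘ id             ≈⟨ identityʳ ⟩
      h                  ∎
      where
      module G = Equaliser (equaliser g h)

      e′ = G.lift (proj₁ factor) eq

      sm : ∃[ k ] (I.arr ∘ G.arr) ∘ k ≈ I.arr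
      sm = smallest (I.arr ∘ G.arr)
        (λ a b p → G.mono a b (I.mono _ _
          (Equiv.trans (Equiv.sym assoc) (Equiv.trans p assoc))))
        (proj₁ e′)
        (Equiv.trans assoc (Equiv.trans (∘-congˡ (proj₂ e′)) (proj₂ factor)))

      k = proj₁ sm

      nk≈id : G.arr ∘ k ≈ id
      nk≈id = I.mono _ _ (Equiv.trans (Equiv.sym assoc)
        (Equiv.trans (proj₂ sm) (Equiv.sym identityʳ)))

  -- Opaque: only the properties of an (epi, mono)-factorisation are visible.
  opaque
    image : ∀ {X Y} (f : X ⇒ Y) → EpiMonoFactorisation f
    image {X} {Y} f = record
      { epi     = proj₁ factor
      ; mono    = Forall.arr I
      ; isEpi   = epi
      ; isMono  = Forall.mono I
      ; commute = proj₂ factor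
      }
      where
      R : Pullback (f ×₁ id) (∈ Y)
      R = pullback (f ×₁ id) (∈ Y)
      S : Forall (Pullback.p₁ R)
      S = forall-part (Pullback.p₁ R) (pb-mono (Pullback.isPullback R) ∈-mono)
      Q : Pullback ⟨ π₂ , Forall.arr S ∘ π₁ ⟩ (∈ Y)
      Q = pullback ⟨ π₂ , Forall.arr S ∘ π₁ ⟩ (∈ Y)
      I : Forall (Pullback.p₁ Q)
      I = forall-part (Pullback.p₁ Q) (pb-mono (Pullback.isPullback Q) ∈-mono)
      open Image f R S Q I

  module _ {X Y} (f : X ⇒ Y) where
    open EpiMonoFactorisation (image f) public
      using () renaming (Im to Im⟨_⟩; mono to im⟨_⟩; isMono to im⟨⟩-mono)

  𝒫₁ : ∀ {X Y} → X ⇒ Y → 𝒫 X ⇒ 𝒫 Y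
  𝒫₁ {X} f = ξ im⟨ (f ×₁ id) ∘ ∈ X ⟩ (im⟨⟩-mono ((f ×₁ id) ∘ ∈ X))

  ⟨id,id⟩-mono : ∀ {X} → Mono ⟨ id {X} , id ⟩
  ⟨id,id⟩-mono g h eq = Equiv.trans (Equiv.sym (split g)) (Equiv.trans (∘-congˡ eq) (split h))
    where
    split : ∀ {A Z} (u : Z ⇒ A) → π₁ ∘ (⟨ id , id ⟩ ∘ u) ≈ u
    split u = Equiv.trans (pull project₁) identityˡ

  η : ∀ X → X ⇒ 𝒫 X
  η X = ξ ⟨ id , id ⟩ ⟨id,id⟩-mono

  -- A subobject of X × Y, given by one of its representatives; `_≅_` below is
  -- equality of subobjects.
  record Relation (X Y : Obj) : Set (o ⊔ ℓ ⊔ e) where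
    field
      {dom}  : Obj
      arr    : dom ⇒ X × Y
      isMono : Mono arr

  open Relation

  infix 4 _⊑_ _≅_

  _⊑_ : ∀ {X Y} → Rel (Relation X Y) (ℓ ⊔ e)
  r ⊑ s = ∃[ i ] arr s ∘ i ≈ arr r

  record _≅_ {X Y} (r s : Relation X Y) : Set (ℓ ⊔ e) where
    field
      to      : dom r ⇒ dom s
      from    : dom s ⇒ dom r
      to∘from : to ∘ from ≈ id
      from∘to : from ∘ to ≈ id
      commute : arr s ∘ to ≈ arr r

  idRel : ∀ X → Relation X X
  idRel X = record { arr = ⟨ id , id ⟩ ; isMono = ⟨id,id⟩-mono }

  infixr 9 _⨾_

  _⨾_ : ∀ {X Y Z} → Relation X Y → Relation Y Z → Relation X Z
  r ⨾ s = record { arr = im⟨ span ⟩ ; isMono = im⟨⟩-mono span }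
    where
    open Pullback (pullback (π₂ ∘ arr r) (π₁ ∘ arr s)) renaming (p₁ to μ₁; p₂ to μ₂)
    span = ⟨ π₁ ∘ arr r ∘ μ₁ , π₂ ∘ arr s ∘ μ₂ ⟩

record Endofunctor {o ℓ e} (C : Category o ℓ e) : Set (o ⊔ ℓ ⊔ e) where
  open Category C
  field
    F₀           : Obj → Obj
    F₁           : ∀ {A B} → A ⇒ B → F₀ A ⇒ F₀ B
    identity     : ∀ {A} → F₁ (id {A}) ≈ id
    homomorphism : ∀ {A B D} {f : A ⇒ B} {g : B ⇒ D} → F₁ (g ∘ f) ≈ F₁ g ∘ F₁ f
    F-resp-≈     : ∀ {A B} {f g : A ⇒ B} → f ≈ g → F₁ f ≈ F₁ g

module _ {o ℓ e} {C : Category o ℓ e} (F : Endofunctor C) where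
  open Category C
  open Endofunctor F

  PreservesWeakPullbacks : Set (o ⊔ ℓ ⊔ e)
  PreservesWeakPullbacks =
    ∀ {P A B D} {p₁ : P ⇒ A} {p₂ : P ⇒ B} {f : A ⇒ D} {g : B ⇒ D} →
    IsWeakPullback p₁ p₂ f g → IsWeakPullback (F₁ p₁) (F₁ p₂) (F₁ f) (F₁ g)

  record GoodOrderStructure (p : Level) : Set (o ⊔ ℓ ⊔ e ⊔ suc p) where
    infix 4 _≤_
    field
      -- The order on C(X , F₀ Y) may depend on Y and not only on the object F₀ Y.
      _≤_        : ∀ {X Y} → Rel (X ⇒ F₀ Y) p
      isPreorder : ∀ {X Y} → IsPreorder _≈_ (_≤_ {X} {Y})
      ≤-natural  : ∀ {X X′ Y Y′} {α β : X ⇒ F₀ Y} (f : X′ ⇒ X) (g : Y ⇒ Y′) →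
                   _≤_ {X} {Y} α β → _≤_ {X′} {Y′} (F₁ g ∘ α ∘ f) (F₁ g ∘ β ∘ f)
      ≤-lift     : ∀ {X Y Z} (h : X ⇒ F₀ Z) (k : X ⇒ F₀ Y) (g : Y ⇒ Z) →
                   _≤_ {X} {Z} h (F₁ g ∘ k) →
                   Σ[ k′ ∈ X ⇒ F₀ Y ] _≤_ {X} {Y} k′ k ∧ (h ≈ F₁ g ∘ k′)

  record Coalgebra : Set (o ⊔ ℓ) where
    field
      carrier   : Obj
      structure : carrier ⇒ F₀ carrier

module Simulation {o ℓ e p} (T : Topos o ℓ e) (F : Endofunctor (Topos.category T))
                  (order : GoodOrderStructure F p) where
  open Topos T
  open ToposDefs T
  open Endofunctor F
  open GoodOrderStructure order
  open Coalgebra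
  open Relation

  infix 4 _≤𝒫_

  _≤𝒫_ : ∀ {X Y} → Rel (X ⇒ 𝒫 (F₀ Y)) (o ⊔ ℓ ⊔ e ⊔ p)
  _≤𝒫_ {X} {Y} f g =
    Σ[ Z ∈ Obj ] Σ[ u ∈ Z ⇒ U⟨ g ⟩ ] Σ[ ε ∈ Z ⇒ U⟨ f ⟩ ]
      Epi ε
      ∧ _≤_ {Z} {Y} (π₁ ∘ m⟨ f ⟩ ∘ ε) (π₁ ∘ m⟨ g ⟩ ∘ u)
      ∧ (π₂ ∘ m⟨ f ⟩ ∘ ε ≈ π₂ ∘ m⟨ g ⟩ ∘ u)

  IsToposalAMSimulation : (α β : Coalgebra F) → Relation (carrier α) (carrier β) →
                          Set (o ⊔ ℓ ⊔ e ⊔ p)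
  IsToposalAMSimulation α β ρ =
    ∀ (ρ′ : Relation X Y) → ρ′ ≅ ρ → let r = arr ρ′; R = dom ρ′ in
    Σ[ W ∈ R ⇒ 𝒫 (F₀ R) ]
      _≤𝒫_ {R} {X} (η (F₀ X) ∘ structure α ∘ π₁ ∘ r) (𝒫₁ (F₁ π₁) ∘ 𝒫₁ (F₁ r) ∘ W)
      ∧ _≤𝒫_ {R} {Y} (𝒫₁ (F₁ π₂) ∘ 𝒫₁ (F₁ r) ∘ W) (η (F₀ Y) ∘ structure β ∘ π₂ ∘ r)
    where
    X = carrier α
    Y = carrier β

  AMSimulation : (α β : Coalgebra F) → Set (o ⊔ ℓ ⊔ e ⊔ p)
  AMSimulation α β = Σ (Relation (carrier α) (carrier β)) (IsToposalAMSimulation α β)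

-- Composition is written in diagrammatic order.
record IsLocallyOrdered2Category
  {o ℓ e p} {Obj : Set o} (Hom : Obj → Obj → Set ℓ)
  (_≈_ : ∀ {A B} → Rel (Hom A B) e) (_≤_ : ∀ {A B} → Rel (Hom A B) p)
  (id : ∀ A → Hom A A) (_⨾_ : ∀ {A B C} → Hom A B → Hom B C → Hom A C)
  : Set (o ⊔ ℓ ⊔ e ⊔ p) where
  field
    isPartialOrder : ∀ {A B} → IsPartialOrder (_≈_ {A} {B}) _≤_
    ⨾-mono         : ∀ {A B C} {f f′ : Hom A B} {g g′ : Hom B C} →
                     f ≤ f′ → g ≤ g′ → (f ⨾ g) ≤ (f′ ⨾ g′)
    assoc          : ∀ {A B C D} (f : Hom A B) (g : Hom B C) (h : Hom C D) →
                     ((f ⨾ g) ⨾ h) ≈ (f ⨾ (g ⨾ h))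
    identityˡ      : ∀ {A B} (f : Hom A B) → (id A ⨾ f) ≈ f
    identityʳ      : ∀ {A B} (f : Hom A B) → (f ⨾ id B) ≈ f

{-# OPTIONS --safe #-}

-- Everything is argued with generalised elements: h : Z → A lies in a
-- subobject m of A when it factors through m. Epis are stable under pullback and
-- left orthogonal to monos, so existential statements (membership in images,
-- in 𝒫f, in a composite of relations) hold exactly when they are witnessed after
-- passing to an epi Z′ → Z.
--
-- A relation R with legs a, b is a toposal AM-simulation iff there are an epi
-- e : Z → R and w : Z → FR with α a e ≤ Fa w and Fb w ≤ β b e: one obtains
-- w by choosing locally an element of W, and conversely W is the image of ⟨w, e⟩.
-- In this form simulations compose as usual: the good order lifts
-- Fb w ≤ F b′ w′ to an equality with some w″ ≤ w′, and preservation of weak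
-- pullbacks amalgamates w and w″.
module Submission where

open import Defs
open import Data.Product using (Σ; Σ-syntax; ∃-syntax; _,_; proj₁; proj₂)
  renaming (_×_ to _∧_)
open import Level using (_⊔_)
open import Relation.Binary.Structures using (IsPreorder)

-- Generalised elements of subobjects.

module GeneralisedElements {o ℓ e} (T : Topos o ℓ e) where
  open Topos T
  open ToposDefs T
  open Basics
  open Equiv
  open HomReasoning

  infix 4 _⊲_

  _⊲_ : ∀ {Z S A} → Z ⇒ A → S ⇒ A → Set (ℓ ⊔ e)
  h ⊲ m = ∃[ k ] m ∘ k ≈ h

  private variable
    A B D X Y Z : Obj

  ⊲-resp : ∀ {S} {m : S ⇒ A} {h h′ : Z ⇒ A} → h ≈ h′ → h ⊲ m → h′ ⊲ m
  ⊲-resp eq (k , mk) = k , trans mk eq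

  ⊲-∘ : ∀ {S} {m : S ⇒ A} {h : Z ⇒ A} (g : Y ⇒ Z) → h ⊲ m → h ∘ g ⊲ m
  ⊲-∘ g (k , mk) = k ∘ g , pull mk

  ⊲-trans : ∀ {S S′} {m : S ⇒ A} {n : S′ ⇒ A} {h : Z ⇒ A} → h ⊲ m → m ⊲ n → h ⊲ n
  ⊲-trans (k , mk) (l , nl) = l ∘ k , trans (pull nl) mk

  ⊲-⟨⟩∘ : ∀ {S} {m : S ⇒ A × B} {x : Z ⇒ A} {y : Z ⇒ B} (g : Y ⇒ Z) →
          ⟨ x , y ⟩ ⊲ m → ⟨ x ∘ g , y ∘ g ⟩ ⊲ m
  ⊲-⟨⟩∘ g x∈m = ⊲-resp ⟨⟩∘ (⊲-∘ g x∈m)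

  ⟨⟩-η : {h : Z ⇒ A × B} → ⟨ π₁ ∘ h , π₂ ∘ h ⟩ ≈ h
  ⟨⟩-η = ×-unique _ _ project₁ project₂

  ⟨⟩-inj₁ : {x x′ : Z ⇒ A} {y y′ : Z ⇒ B} → ⟨ x , y ⟩ ≈ ⟨ x′ , y′ ⟩ → x ≈ x′
  ⟨⟩-inj₁ eq = trans (sym project₁) (trans (∘-congˡ eq) project₁)

  ⟨⟩-inj₂ : {x x′ : Z ⇒ A} {y y′ : Z ⇒ B} → ⟨ x , y ⟩ ≈ ⟨ x′ , y′ ⟩ → y ≈ y′
  ⟨⟩-inj₂ eq = trans (sym project₂) (trans (∘-congˡ eq) project₂)

  id-epi : Epi (id {A})
  id-epi g h eq = trans (sym identityʳ) (trans eq identityʳ)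

  ∘-epi : {f : B ⇒ D} {g : A ⇒ B} → Epi f → Epi g → Epi (f ∘ g)
  ∘-epi f-epi g-epi h k eq =
    f-epi h k (g-epi _ _ (trans assoc (trans eq (sym assoc))))

  section-epi : {f : A ⇒ B} {g : B ⇒ A} → f ∘ g ≈ id → Epi f
  section-epi {f = f} {g} fg≈id h k eq = begin
    h            ≈⟨ identityʳ ⟨
    h ∘ id       ≈⟨ ∘-congˡ fg≈id ⟨
    h ∘ (f ∘ g)  ≈⟨ pull eq ⟩
    (k ∘ f) ∘ g  ≈⟨ assoc ⟩
    k ∘ (f ∘ g)  ≈⟨ ∘-congˡ fg≈id ⟩
    k ∘ id       ≈⟨ identityʳ ⟩
    k            ∎

  -- Membership in power objects.

  infix 4 _∈∈_

  _∈∈_ : Z ⇒ X → Z ⇒ 𝒫 X → Set (ℓ ⊔ e)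
  _∈∈_ {X = X} x a = ⟨ x , a ⟩ ⊲ ∈ X

  opaque
    ∈∈-resp : {x x′ : Z ⇒ X} {a a′ : Z ⇒ 𝒫 X} → x ≈ x′ → a ≈ a′ → x ∈∈ a → x′ ∈∈ a′
    ∈∈-resp p q = ⊲-resp (⟨⟩-cong p q)

  -- The pullback property read on elements. Any classifying square is allowed, which covers both
  -- `ξ m` and the chosen mono `m⟨ f ⟩`.
  module Classified {X Y R} {m : R ⇒ X × Y} {h : Y ⇒ 𝒫 X}
                    (c : IsPullbackOfAlong m (∈ X) (id ×₁ h)) where
    private module pb = IsPullback (proj₂ c)

    id×h∘⟨⟩ : {x : Z ⇒ X} {y : Z ⇒ Y} → (id ×₁ h) ∘ ⟨ x , y ⟩ ≈ ⟨ x , h ∘ y ⟩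
    id×h∘⟨⟩ = trans ×₁∘⟨⟩ (⟨⟩-cong identityˡ refl)

    to : {x : Z ⇒ X} {y : Z ⇒ Y} → x ∈∈ h ∘ y → ⟨ x , y ⟩ ⊲ m
    to (k , eq) = pb.universal _ k (trans id×h∘⟨⟩ (sym eq)) , pb.p₁∘universal

    from : {x : Z ⇒ X} {y : Z ⇒ Y} → ⟨ x , y ⟩ ⊲ m → x ∈∈ h ∘ y
    from {x = x} {y} (k , eq) = proj₁ c ∘ k , (begin
      ∈ X ∘ (proj₁ c ∘ k)     ≈⟨ pull (sym pb.commute) ⟩
      ((id ×₁ h) ∘ m) ∘ k     ≈⟨ assoc ⟩
      (id ×₁ h) ∘ (m ∘ k)     ≈⟨ ∘-congˡ eq ⟩
      (id ×₁ h) ∘ ⟨ x , y ⟩   ≈⟨ id×h∘⟨⟩ ⟩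
      ⟨ x , h ∘ y ⟩           ∎)

  module ∈ξ {X Y R} {m : R ⇒ X × Y} {m-mono : Mono m} = Classified (ξ-pb m m-mono)

  module ∈m⟨⟩ {X Y} (f : Y ⇒ 𝒫 X) = Classified {h = f} (_ , Pullback.isPullback (pullback (id ×₁ f) (∈ X)))

  -- The two inclusions make `m⟨ b ⟩` a pullback of `∈ X` along `id ×₁ a` as well, so uniqueness of
  -- characters applies: `b⊆a` at the generic element of `b` gives the square, `a⊆b` its universal
  -- property.
  𝒫-ext : (a b : Y ⇒ 𝒫 X) →
          (∀ {Z} (x : Z ⇒ X) (y : Z ⇒ Y) → x ∈∈ a ∘ y → x ∈∈ b ∘ y) →
          (∀ {Z} (x : Z ⇒ X) (y : Z ⇒ Y) → x ∈∈ b ∘ y → x ∈∈ a ∘ y) →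
          a ≈ b
  𝒫-ext {X = X} a b a⊆b b⊆a = trans (ξ-unique m (m⟨⟩-mono b) a (proj₁ generic , record
    { commute      = sym generic-eq
    ; universal    = λ h₁ h₂ sq → proj₁ (lift h₁ h₂ sq)
    ; p₁∘universal = λ {_} {h₁} {h₂} {sq} → proj₂ (lift h₁ h₂ sq)
    ; p₂∘universal = λ {_} {h₁} {h₂} {sq} → ∈-mono _ _ (begin
        ∈ X ∘ (proj₁ generic ∘ proj₁ (lift h₁ h₂ sq)) ≈⟨ pull generic-eq ⟩
        ((id ×₁ a) ∘ m) ∘ proj₁ (lift h₁ h₂ sq)       ≈⟨ assoc ⟩
        (id ×₁ a) ∘ (m ∘ proj₁ (lift h₁ h₂ sq))       ≈⟨ ∘-congˡ (proj₂ (lift h₁ h₂ sq)) ⟩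
        (id ×₁ a) ∘ h₁                                ≈⟨ sq ⟩
        ∈ X ∘ h₂                                      ∎)
    ; unique       = λ u v p _ → m⟨⟩-mono b u v p
    })) (sym (ξ-m⟨⟩ b))
    where
    m = m⟨ b ⟩

    id×a∘ : ∀ {Z} {h : Z ⇒ X × _} → (id ×₁ a) ∘ h ≈ ⟨ π₁ ∘ h , a ∘ (π₂ ∘ h) ⟩
    id×a∘ = trans (∘-congˡ (sym ⟨⟩-η)) (trans ×₁∘⟨⟩ (⟨⟩-cong identityˡ refl))

    generic : π₁ ∘ m ∈∈ a ∘ (π₂ ∘ m)
    generic = b⊆a _ _ (∈m⟨⟩.from b (⊲-resp (sym ⟨⟩-η) (id , identityʳ)))

    generic-eq : ∈ X ∘ proj₁ generic ≈ (id ×₁ a) ∘ m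
    generic-eq = trans (proj₂ generic) (sym id×a∘)

    lift : ∀ {Q} (h₁ : Q ⇒ X × _) (h₂ : Q ⇒ E X) → (id ×₁ a) ∘ h₁ ≈ ∈ X ∘ h₂ → h₁ ⊲ m
    lift h₁ h₂ sq = ⊲-resp ⟨⟩-η (∈m⟨⟩.to b (a⊆b _ _ (h₂ , trans (sym sq) id×a∘)))

  -- Epis as covers: pullback stability and descent.

  ⟨id,⟩-mono : {g : A ⇒ B} → Mono ⟨ id , g ⟩
  ⟨id,⟩-mono u v eq = trans (sym split) (trans (∘-congˡ eq) split)
    where
    split : ∀ {w} → π₁ ∘ (⟨ id , _ ⟩ ∘ w) ≈ w
    split = trans (pull project₁) identityˡ

  ∘-mono : {f : B ⇒ D} {g : A ⇒ B} → Mono f → Mono g → Mono (f ∘ g)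
  ∘-mono f-mono g-mono u v eq =
    g-mono u v (f-mono _ _ (trans (sym assoc) (trans eq assoc)))

  -- If h and k agree on p₁, then p₁ factors through their equaliser n, so the graph of
  -- g and its restriction to n, as relations from A to B, have the same pullback
  -- along id × f; hence their characters B → 𝒫 A agree on f.
  epi-stable : ∀ {P} {p₁ : P ⇒ A} {p₂ : P ⇒ D} {g : A ⇒ B} {f : D ⇒ B} →
               IsPullback p₁ p₂ g f → Epi f → Epi p₁
  epi-stable {A} {D} {B} {p₁ = p₁} {g = g} {f} pb f-epi h k eq = begin
    h              ≈⟨ identityʳ ⟨
    h ∘ id         ≈⟨ ∘-congˡ n∘v ⟨
    h ∘ (n ∘ v)    ≈⟨ pull N.equal ⟩
    (k ∘ n) ∘ v    ≈⟨ assoc ⟩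
    k ∘ (n ∘ v)    ≈⟨ ∘-congˡ n∘v ⟩
    k ∘ id         ≈⟨ identityʳ ⟩
    k              ∎
    where
    module pb = IsPullback pb
    module N = Equaliser (equaliser h k)
    n = N.arr
    graph = ⟨ id , g ⟩
    ξ₁ = ξ graph ⟨id,⟩-mono
    ξ₂ = ξ (graph ∘ n) (∘-mono ⟨id,⟩-mono N.mono)

    graph∘ : ∀ {Z} (u : Z ⇒ A) → graph ∘ u ≈ ⟨ u , g ∘ u ⟩
    graph∘ u = trans ⟨⟩∘ (⟨⟩-cong identityˡ refl)

    restrict : ∀ {Z} (x : Z ⇒ A) (y : Z ⇒ D) → ⟨ x , f ∘ y ⟩ ⊲ graph → ⟨ x , f ∘ y ⟩ ⊲ graph ∘ n
    restrict x y (u , gu) = proj₁ p₁⊲n ∘ w , (begin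
      (graph ∘ n) ∘ (proj₁ p₁⊲n ∘ w)  ≈⟨ assoc ⟩
      graph ∘ (n ∘ (proj₁ p₁⊲n ∘ w))  ≈⟨ ∘-congˡ (pull (proj₂ p₁⊲n)) ⟩
      graph ∘ (p₁ ∘ w)                ≈⟨ ∘-congˡ pb.p₁∘universal ⟩
      graph ∘ u                       ≈⟨ gu ⟩
      ⟨ x , f ∘ y ⟩                   ∎)
      where
      p₁⊲n = N.lift p₁ eq
      w = pb.universal u y (⟨⟩-inj₂ (trans (sym (graph∘ u)) gu))

    extend : ∀ {Z} {z : Z ⇒ A × B} → z ⊲ graph ∘ n → z ⊲ graph
    extend (u , gu) = n ∘ u , trans (sym assoc) gu

    ξ₁≈ξ₂ : ξ₁ ≈ ξ₂
    ξ₁≈ξ₂ = f-epi _ _ (𝒫-ext _ _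
      (λ x y x∈ → ∈∈-resp refl (sym assoc) (∈ξ.from (restrict x y (∈ξ.to (∈∈-resp refl assoc x∈)))))
      (λ x y x∈ → ∈∈-resp refl (sym assoc) (∈ξ.from (extend (∈ξ.to (∈∈-resp refl assoc x∈))))))

    id∈ : ⟨ id , g ⟩ ⊲ graph ∘ n
    id∈ = ∈ξ.to (∈∈-resp refl (∘-congʳ ξ₁≈ξ₂) (∈ξ.from (id , identityʳ)))

    v = proj₁ id∈

    n∘v : n ∘ v ≈ id
    n∘v = ⟨⟩-inj₁ (trans (sym (graph∘ _)) (trans (sym assoc) (proj₂ id∈)))

  record Cover (V : Obj) : Set (o ⊔ ℓ ⊔ e) where
    field
      {src} : Obj
      map   : src ⇒ V
      isEpi : Epi map

  open Cover public using (src; map)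

  opaque
    -- Stability of epis turns `ε` into local lifts: the cover is the pullback of `ε` along `h`.
    pull-cover : {ε : A ⇒ B} → Epi ε → (h : Z ⇒ B) →
                 Σ[ c ∈ Cover Z ] ∃[ z ] ε ∘ z ≈ h ∘ map c
    pull-cover {ε = ε} ε-epi h =
      record { map = p₁ ; isEpi = epi-stable isPullback ε-epi } , p₂ , sym commute
      where open Pullback (pullback h ε)

  infixr 9 _∘ᶜ_

  _∘ᶜ_ : (c : Cover Z) → Cover (src c) → Cover Z
  c ∘ᶜ c′ = record { map = map c ∘ map c′ ; isEpi = ∘-epi (Cover.isEpi c) (Cover.isEpi c′) }

  -- As relations from ⊤ to A, the subobject s and the whole of A
  -- have characters that agree on r, since they agree on r ∘ ε.
  epi-local : ∀ {S R} {s : S ⇒ A} {r : R ⇒ A} {ε : Z ⇒ R} →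
              Mono s → Epi ε → r ∘ ε ⊲ s → r ⊲ s
  epi-local {A} {s = s} {r} {ε} s-mono ε-epi rε⊲s = ⟨!,s⟩→s
    (∈ξ.to (∈∈-resp refl (sym ξs≈ξ⊤) (∈ξ.from (⟨ ! , r ⟩ , identityˡ))))
    where
    ⟨!,s⟩→s : ∀ {Z} {x : Z ⇒ ⊤} {y : Z ⇒ A} → ⟨ x , y ⟩ ⊲ ⟨ ! , s ⟩ → y ⊲ s
    ⟨!,s⟩→s (k , eq) = k , ⟨⟩-inj₂ (trans (sym ⟨⟩∘) eq)

    s→⟨!,s⟩ : ∀ {Z} {x : Z ⇒ ⊤} {y : Z ⇒ A} → y ⊲ s → ⟨ x , y ⟩ ⊲ ⟨ ! , s ⟩
    s→⟨!,s⟩ (k , eq) = k , trans ⟨⟩∘ (⟨⟩-cong (!-unique _ _) eq)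

    ξs = ξ ⟨ ! {_} , s ⟩ λ g h eq → s-mono g h (⟨⟩-inj₂ (trans (sym ⟨⟩∘) (trans eq ⟨⟩∘)))
    ξ⊤ = ξ (id {⊤ × A}) id-mono

    reassoc : ∀ {Z} {z : Z ⇒ _} {a : A ⇒ 𝒫 ⊤} → ((a ∘ r) ∘ ε) ∘ z ≈ a ∘ ((r ∘ ε) ∘ z)
    reassoc = trans (∘-congʳ assoc) assoc

    ξs≈ξ⊤ : ξs ∘ r ≈ ξ⊤ ∘ r
    ξs≈ξ⊤ = ε-epi _ _ (𝒫-ext _ _
      (λ x z _ → ∈∈-resp refl (sym reassoc) (∈ξ.from (_ , identityˡ)))
      (λ x z _ → ∈∈-resp refl (sym reassoc) (∈ξ.from (s→⟨!,s⟩ (⊲-∘ z rε⊲s)))))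

  -- The tool for discarding covers: by orthogonality, membership in a mono descends along an epi.
  ⊲-local : ∀ {S} {m : S ⇒ A × B} → Mono m → (c : Cover Z) {x : Z ⇒ A} {y : Z ⇒ B} →
            ⟨ x ∘ map c , y ∘ map c ⟩ ⊲ m → ⟨ x , y ⟩ ⊲ m
  ⊲-local m-mono c x∈m = epi-local m-mono (Cover.isEpi c) (⊲-resp (sym ⟨⟩∘) x∈m)

  -- Images, singletons and direct images.

  module _ {X Y} {f : X ⇒ Y} where
    private module im = EpiMonoFactorisation (image f)

    opaque
      image-elim : {y : Z ⇒ Y} → y ⊲ im⟨ f ⟩ → Σ[ c ∈ Cover Z ] ∃[ x ] f ∘ x ≈ y ∘ map c
      image-elim {y = y} (k , eq) =
        let c , x , sq = pull-cover im.isEpi k in c , x , (begin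
          f ∘ x                       ≈⟨ ∘-congʳ im.commute ⟨
          (im.mono ∘ im.epi) ∘ x      ≈⟨ assoc ⟩
          im.mono ∘ (im.epi ∘ x)      ≈⟨ ∘-congˡ sq ⟩
          im.mono ∘ (k ∘ map c)       ≈⟨ pull eq ⟩
          y ∘ map c                   ∎)

    image-intro : f ⊲ im⟨ f ⟩
    image-intro = im.epi , im.commute

    -- The epi part of the factorisation is orthogonal to `s`.
    image-least : ∀ {S} {s : S ⇒ Y} → Mono s → f ⊲ s → im⟨ f ⟩ ⊲ s
    image-least s-mono f⊲s = epi-local s-mono im.isEpi (⊲-resp (sym im.commute) f⊲s)

  -- `η` classifies the diagonal, so `η X ∘ y` is the singleton of `y`.
  η-elim : {x y : Z ⇒ X} → x ∈∈ η X ∘ y → x ≈ y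
  η-elim {x = x} {y} x∈ = trans (sym k≈x) k≈y
    where
    k = ∈ξ.to x∈
    eq : ⟨ proj₁ k , proj₁ k ⟩ ≈ ⟨ x , y ⟩
    eq = trans (sym (trans ⟨⟩∘ (⟨⟩-cong identityˡ identityˡ))) (proj₂ k)
    k≈x = ⟨⟩-inj₁ eq
    k≈y = ⟨⟩-inj₂ eq

  η-intro : {x : Z ⇒ X} → x ∈∈ η X ∘ x
  η-intro {x = x} = ∈ξ.from (x , trans ⟨⟩∘ (⟨⟩-cong identityˡ identityˡ))

  module _ {X Y Z} {f : X ⇒ Y} {a : Z ⇒ 𝒫 X} where
    private
      f×id∈ : ∀ {V} {k : V ⇒ E X} {x : V ⇒ X} {b : V ⇒ 𝒫 X} → ∈ X ∘ k ≈ ⟨ x , b ⟩ →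
              ((f ×₁ id) ∘ ∈ X) ∘ k ≈ ⟨ f ∘ x , b ⟩
      f×id∈ eq = trans assoc (trans (∘-congˡ eq) (trans ×₁∘⟨⟩ (⟨⟩-cong refl identityˡ)))

    𝒫₁-intro : {x : Z ⇒ X} → x ∈∈ a → f ∘ x ∈∈ 𝒫₁ f ∘ a
    𝒫₁-intro (k , eq) = ∈ξ.from (⊲-resp (f×id∈ eq) (⊲-∘ k image-intro))

    opaque
      𝒫₁-elim : {y : Z ⇒ Y} → y ∈∈ 𝒫₁ f ∘ a →
                Σ[ c ∈ Cover Z ] ∃[ x ] (x ∈∈ a ∘ map c) ∧ (f ∘ x ≈ y ∘ map c)
      𝒫₁-elim y∈ =
        let c , k , eq = image-elim (∈ξ.to y∈)
            sq = trans (sym (f×id∈ (sym ⟨⟩-η))) (trans eq ⟨⟩∘)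
        -- `f ×₁ id` fixes the second component; `sq` therefore places `k` over `a` itself.
        in c , π₁ ∘ (∈ X ∘ k) , (k , trans (sym ⟨⟩-η) (⟨⟩-cong refl (⟨⟩-inj₂ sq))) , ⟨⟩-inj₁ sq

-- Relations under inclusion and composition.

module Relations {o ℓ e} (T : Topos o ℓ e) where
  open Topos T
  open ToposDefs T
  open Basics
  open Equiv
  open HomReasoning
  open GeneralisedElements T
  open Relation

  ⊑-antisym : ∀ {X Y} {r s : Relation X Y} → r ⊑ s → s ⊑ r → r ≅ s
  ⊑-antisym {r = r} {s} (i , si) (j , rj) = record
    { to      = i
    ; from    = j
    ; to∘from = isMono s _ _ (trans (pull si) (trans rj (sym identityʳ)))
    ; from∘to = isMono r _ _ (trans (pull rj) (trans si (sym identityʳ)))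
    ; commute = si
    }

  module _ {X Y} {r s : Relation X Y} (i : r ≅ s) where
    open _≅_ i

    ≅⇒⊑ : r ⊑ s
    ≅⇒⊑ = to , commute

    ≅⇒⊒ : s ⊑ r
    ≅⇒⊒ = from , (begin
      arr r ∘ from          ≈⟨ ∘-congʳ commute ⟨
      (arr s ∘ to) ∘ from   ≈⟨ assoc ⟩
      arr s ∘ (to ∘ from)   ≈⟨ ∘-congˡ to∘from ⟩
      arr s ∘ id            ≈⟨ identityʳ ⟩
      arr s                 ∎)

  ⊑-refl : ∀ {X Y} {r : Relation X Y} → r ⊑ r
  ⊑-refl = id , identityʳ

  ≅-refl : ∀ {X Y} {r : Relation X Y} → r ≅ r
  ≅-refl {r = r} = ⊑-antisym {r = r} {r} (⊑-refl {r = r}) (⊑-refl {r = r})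

  module Composite {X Y Z} (r : Relation X Y) (s : Relation Y Z) where
    private module pb = Pullback (pullback (π₂ ∘ arr r) (π₁ ∘ arr s))

    ⨾-intro : ∀ {V} {x : V ⇒ X} {y : V ⇒ Y} {z : V ⇒ Z} →
              ⟨ x , y ⟩ ⊲ arr r → ⟨ y , z ⟩ ⊲ arr s → ⟨ x , z ⟩ ⊲ arr (r ⨾ s)
    ⨾-intro {x = x} {y} {z} (k , rk) (l , sl) = ⊲-resp
      (trans ⟨⟩∘ (⟨⟩-cong
        (begin
          (π₁ ∘ arr r ∘ pb.p₁) ∘ u  ≈⟨ trans assoc (∘-congˡ assoc) ⟩
          π₁ ∘ arr r ∘ pb.p₁ ∘ u    ≈⟨ ∘-congˡ (∘-congˡ pb.p₁∘universal) ⟩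
          π₁ ∘ arr r ∘ k            ≈⟨ ∘-congˡ rk ⟩
          π₁ ∘ ⟨ x , y ⟩            ≈⟨ project₁ ⟩
          x                         ∎)
        (begin
          (π₂ ∘ arr s ∘ pb.p₂) ∘ u  ≈⟨ trans assoc (∘-congˡ assoc) ⟩
          π₂ ∘ arr s ∘ pb.p₂ ∘ u    ≈⟨ ∘-congˡ (∘-congˡ pb.p₂∘universal) ⟩
          π₂ ∘ arr s ∘ l            ≈⟨ ∘-congˡ sl ⟩
          π₂ ∘ ⟨ y , z ⟩            ≈⟨ project₂ ⟩
          z                         ∎)))
      (⊲-∘ u image-intro)
      where
      u = pb.universal k l (begin
        (π₂ ∘ arr r) ∘ k   ≈⟨ trans assoc (∘-congˡ rk) ⟩
        π₂ ∘ ⟨ x , y ⟩     ≈⟨ trans project₂ (sym project₁) ⟩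
        π₁ ∘ ⟨ y , z ⟩     ≈⟨ trans assoc (∘-congˡ sl) ⟨
        (π₁ ∘ arr s) ∘ l   ∎)

    private
      middle : pb.P ⇒ Y
      middle = π₂ ∘ arr r ∘ pb.p₁

      left : ⟨ π₁ ∘ arr r ∘ pb.p₁ , middle ⟩ ⊲ arr r
      left = pb.p₁ , sym ⟨⟩-η

      right : ⟨ middle , π₂ ∘ arr s ∘ pb.p₂ ⟩ ⊲ arr s
      right = pb.p₂ , trans (sym ⟨⟩-η)
        (⟨⟩-cong (trans (sym assoc) (trans (sym pb.commute) assoc)) refl)

    -- The composite is an image, so a middle element exists only on a cover.
    ⨾-elim : ∀ {V} {x : V ⇒ X} {z : V ⇒ Z} → ⟨ x , z ⟩ ⊲ arr (r ⨾ s) →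
             Σ[ c ∈ Cover V ] ∃[ y ]
               (⟨ x ∘ map c , y ⟩ ⊲ arr r) ∧ (⟨ y , z ∘ map c ⟩ ⊲ arr s)
    ⨾-elim xz∈ =
      let c , u , eq = image-elim xz∈
          sq = trans (sym ⟨⟩∘) (trans eq ⟨⟩∘)
      in c , middle ∘ u
        , ⊲-resp (⟨⟩-cong (⟨⟩-inj₁ sq) refl) (⊲-⟨⟩∘ u left)
        , ⊲-resp (⟨⟩-cong refl (⟨⟩-inj₂ sq)) (⊲-⟨⟩∘ u right)

    -- As images are least, it suffices to test the generic composable pair, which lives on the
    -- pullback.
    ⨾-least : (t : Relation X Z) →
              (∀ {V} {x : V ⇒ X} {y : V ⇒ Y} {z : V ⇒ Z} →
                ⟨ x , y ⟩ ⊲ arr r → ⟨ y , z ⟩ ⊲ arr s → ⟨ x , z ⟩ ⊲ arr t) →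
              r ⨾ s ⊑ t
    ⨾-least t f = image-least (isMono t) (f left right)

  open Composite

  ⨾-mono : ∀ {X Y Z} (r r′ : Relation X Y) (s s′ : Relation Y Z) →
           r ⊑ r′ → s ⊑ s′ → r ⨾ s ⊑ r′ ⨾ s′
  ⨾-mono r r′ s s′ r⊑r′ s⊑s′ = ⨾-least r s (r′ ⨾ s′)
    λ xy yz → ⨾-intro r′ s′ (⊲-trans xy r⊑r′) (⊲-trans yz s⊑s′)

  ⨾-assoc : ∀ {X Y Z V} (r : Relation X Y) (s : Relation Y Z) (t : Relation Z V) →
            (r ⨾ s) ⨾ t ≅ r ⨾ (s ⨾ t)
  ⨾-assoc r s t = ⊑-antisym {r = (r ⨾ s) ⨾ t} {r ⨾ (s ⨾ t)}
    (⨾-least (r ⨾ s) t (r ⨾ (s ⨾ t)) λ xz zv →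
      -- `y` exists only on `c`, but the goal is membership in a mono and so descends.
      let c , y , xy , yz = ⨾-elim r s xz in
      ⊲-local (isMono (r ⨾ (s ⨾ t))) c
        (⨾-intro r (s ⨾ t) xy (⨾-intro s t yz (⊲-⟨⟩∘ (map c) zv))))
    (⨾-least r (s ⨾ t) ((r ⨾ s) ⨾ t) λ xy yv →
      let c , z , yz , zv = ⨾-elim s t yv in
      ⊲-local (isMono ((r ⨾ s) ⨾ t)) c
        (⨾-intro (r ⨾ s) t (⨾-intro r s (⊲-⟨⟩∘ (map c) xy) yz) zv))

  ∈idRel⇒≈ : ∀ {X V} {x y : V ⇒ X} → ⟨ x , y ⟩ ⊲ arr (idRel X) → x ≈ y
  ∈idRel⇒≈ x∈ = η-elim (∈ξ.from x∈)

  diagonal∈idRel : ∀ {X V} {x : V ⇒ X} → ⟨ x , x ⟩ ⊲ arr (idRel X)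
  diagonal∈idRel = ∈ξ.to η-intro

  generic : ∀ {X Y} (r : Relation X Y) → ⟨ π₁ ∘ arr r , π₂ ∘ arr r ⟩ ⊲ arr r
  generic r = ⊲-resp (sym ⟨⟩-η) (id , identityʳ)

  ⨾-identityˡ : ∀ {X Y} (r : Relation X Y) → idRel X ⨾ r ≅ r
  ⨾-identityˡ {X} r = ⊑-antisym {r = idRel X ⨾ r} {r}
    (⨾-least (idRel X) r r λ xy yz → ⊲-resp (⟨⟩-cong (sym (∈idRel⇒≈ xy)) refl) yz)
    (⊲-resp ⟨⟩-η (⨾-intro (idRel X) r diagonal∈idRel (generic r)))

  ⨾-identityʳ : ∀ {X Y} (r : Relation X Y) → r ⨾ idRel Y ≅ r
  ⨾-identityʳ {Y = Y} r = ⊑-antisym {r = r ⨾ idRel Y} {r}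
    (⨾-least r (idRel Y) r λ xy yz → ⊲-resp (⟨⟩-cong refl (∈idRel⇒≈ yz)) xy)
    (⊲-resp ⟨⟩-η (⨾-intro r (idRel Y) (generic r) diagonal∈idRel))

-- Good orders and toposal simulations.

module Simulations {o ℓ e p} (T : Topos o ℓ e) (F : Endofunctor (Topos.category T))
                   (order : GoodOrderStructure F p) where
  open Topos T
  open ToposDefs T
  open Basics
  open Equiv
  open HomReasoning
  open GeneralisedElements T
  open Relations T
  open Relation
  open Endofunctor F
  open GoodOrderStructure order
  open Simulation T F order
  open Coalgebra

  private variable
    V X Y Z : Obj

  module ≤ {X Y} = IsPreorder (isPreorder {X} {Y})

  ≤-resp : {a a′ b b′ : X ⇒ F₀ Y} → a ≈ a′ → b ≈ b′ → _≤_ {X} {Y} a b → _≤_ {X} {Y} a′ b′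
  ≤-resp p q a≤b = ≤.trans (≤.reflexive (sym p)) (≤.trans a≤b (≤.reflexive q))

  ≤-∘ : {a b : X ⇒ F₀ Y} (f : Z ⇒ X) → _≤_ {X} {Y} a b → _≤_ {Z} {Y} (a ∘ f) (b ∘ f)
  ≤-∘ {Y = Y} f a≤b = ≤-resp unit unit (≤-natural f (id {Y}) a≤b)
    where
    unit : ∀ {a} → F₁ id ∘ a ∘ f ≈ a ∘ f
    unit = trans (∘-congʳ identity) identityˡ

  F∘-≤ : {a b : X ⇒ F₀ Y} (g : Y ⇒ Z) → _≤_ {X} {Y} a b → _≤_ {X} {Z} (F₁ g ∘ a) (F₁ g ∘ b)
  F∘-≤ g a≤b = ≤-resp (∘-congˡ identityʳ) (∘-congˡ identityʳ) (≤-natural id g a≤b)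

  -- Pulling `ε` back along the factorisation `k` of `⟨ t , x ⟩` through `m⟨ f ⟩` makes `t` locally
  -- a value of `π₁ ∘ m⟨ f ⟩ ∘ ε`, for which `u` supplies the bound; equality of second components
  -- keeps that bound over `x`.
  ≤𝒫-elim : {f g : V ⇒ 𝒫 (F₀ Y)} → _≤𝒫_ {V} {Y} f g →
            {t : Z ⇒ F₀ Y} {x : Z ⇒ V} → t ∈∈ f ∘ x →
            Σ[ c ∈ Cover Z ] Σ[ t′ ∈ src c ⇒ F₀ Y ]
              _≤_ {src c} {Y} (t ∘ map c) t′ ∧ (t′ ∈∈ g ∘ (x ∘ map c))
  ≤𝒫-elim {f = f} {g} (_ , u , ε , ε-epi , le , eq) {t} {x} t∈ =
    let k , mk = ∈m⟨⟩.to f t∈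
        c , z , sq = pull-cover ε-epi k
        m∘ε∘z = begin
          (m⟨ f ⟩ ∘ ε) ∘ z          ≈⟨ trans assoc (∘-congˡ sq) ⟩
          m⟨ f ⟩ ∘ (k ∘ map c)      ≈⟨ pull mk ⟩
          ⟨ t , x ⟩ ∘ map c         ≈⟨ ⟨⟩∘ ⟩
          ⟨ t ∘ map c , x ∘ map c ⟩ ∎
    in c , (π₁ ∘ m⟨ g ⟩ ∘ u) ∘ z
       , ≤-resp (trans assoc (trans (∘-congˡ m∘ε∘z) project₁)) refl (≤-∘ z le)
       , ∈m⟨⟩.from g (u ∘ z , (begin
           m⟨ g ⟩ ∘ (u ∘ z)
             ≈⟨ sym assoc ⟩
           (m⟨ g ⟩ ∘ u) ∘ z
             ≈⟨ ⟨⟩-η ⟨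
           ⟨ π₁ ∘ ((m⟨ g ⟩ ∘ u) ∘ z) , π₂ ∘ ((m⟨ g ⟩ ∘ u) ∘ z) ⟩
             ≈⟨ ⟨⟩-cong (sym assoc) (begin
                  π₂ ∘ ((m⟨ g ⟩ ∘ u) ∘ z)   ≈⟨ pull (sym eq) ⟩
                  (π₂ ∘ m⟨ f ⟩ ∘ ε) ∘ z     ≈⟨ trans assoc (∘-congˡ m∘ε∘z) ⟩
                  π₂ ∘ ⟨ t ∘ map c , x ∘ map c ⟩ ≈⟨ project₂ ⟩
                  x ∘ map c                 ∎) ⟩
           ⟨ (π₁ ∘ m⟨ g ⟩ ∘ u) ∘ z , x ∘ map c ⟩ ∎))

  -- The generic element, carried by `U⟨ f ⟩`, is the universal case; the cover found for it serves
  -- as the epi.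
  ≤𝒫-intro : {f g : V ⇒ 𝒫 (F₀ Y)} →
             (∀ {Z} {t : Z ⇒ F₀ Y} {x : Z ⇒ V} → t ∈∈ f ∘ x →
               Σ[ c ∈ Cover Z ] Σ[ t′ ∈ src c ⇒ F₀ Y ]
                 _≤_ {src c} {Y} (t ∘ map c) t′ ∧ (t′ ∈∈ g ∘ (x ∘ map c))) →
             _≤𝒫_ {V} {Y} f g
  ≤𝒫-intro {f = f} {g} below =
    let c , t′ , le , t′∈ = below (∈m⟨⟩.from f (id , trans identityʳ (sym ⟨⟩-η)))
        u , mu = ∈m⟨⟩.to g t′∈
    in src c , u , map c , Cover.isEpi c
       , ≤-resp assoc (trans (sym project₁) (∘-congˡ (sym mu))) le
       , trans (sym assoc) (trans (sym project₂) (∘-congˡ (sym mu)))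

  -- Stated for arbitrary legs rather than for a mono, so that the pullback underlying a composite
  -- of relations qualifies before its image is taken.
  record AMSpan (α β : Coalgebra F) {R} (a : R ⇒ carrier α) (b : R ⇒ carrier β) :
                Set (o ⊔ ℓ ⊔ e ⊔ p) where
    field
      cover : Cover R
      w     : src cover ⇒ F₀ R
      lower : _≤_ {src cover} {carrier α} ((structure α ∘ a) ∘ map cover) (F₁ a ∘ w)
      upper : _≤_ {src cover} {carrier β} (F₁ b ∘ w) ((structure β ∘ b) ∘ map cover)

  AMSpan-id : (α : Coalgebra F) → AMSpan α α id id
  AMSpan-id α = record
    { cover = record { map = id ; isEpi = id-epi }
    ; w     = structure α
    ; lower = ≤.reflexive α∘id
    ; upper = ≤.reflexive (sym α∘id)
    }
    where
    α∘id = begin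
      (structure α ∘ id) ∘ id   ≈⟨ trans identityʳ identityʳ ⟩
      structure α               ≈⟨ identityˡ ⟨
      id ∘ structure α          ≈⟨ ∘-congʳ identity ⟨
      F₁ id ∘ structure α       ∎

  -- `q` after the cover is a cover of `Q`, and `F₁ q` moves the witness. Used for passing to an
  -- image and to another representative of a relation.
  AMSpan-image : ∀ {α β R Q} {a : R ⇒ carrier α} {b : R ⇒ carrier β}
                 {a′ : Q ⇒ carrier α} {b′ : Q ⇒ carrier β} {q : R ⇒ Q} →
                 Epi q → a′ ∘ q ≈ a → b′ ∘ q ≈ b → AMSpan α β a b → AMSpan α β a′ b′
  AMSpan-image {R = R} {Q} {q = q} q-epi a′q b′q s = record
    { cover = record { map = q ∘ map cover ; isEpi = ∘-epi q-epi (Cover.isEpi cover) }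
    ; w     = F₁ q ∘ w
    ; lower = ≤-resp (struct a′q) (functor a′q) lower
    ; upper = ≤-resp (functor b′q) (struct b′q) upper
    }
    where
    open AMSpan s
    struct : ∀ {A B} {h : R ⇒ A} {h′ : Q ⇒ A} {γ : A ⇒ B} → h′ ∘ q ≈ h →
             (γ ∘ h) ∘ map cover ≈ (γ ∘ h′) ∘ (q ∘ map cover)
    struct h′q = trans assoc (trans (∘-congˡ (trans (∘-congʳ (sym h′q)) assoc)) (sym assoc))
    functor : ∀ {A} {h : R ⇒ A} {h′ : Q ⇒ A} → h′ ∘ q ≈ h → F₁ h ∘ w ≈ F₁ h′ ∘ (F₁ q ∘ w)
    functor h′q = sym (pull (trans (sym homomorphism) (F-resp-≈ h′q)))

  IsPullback⇒IsWeakPullback : ∀ {P A B D} {p₁ : P ⇒ A} {p₂ : P ⇒ B} {f : A ⇒ D} {g : B ⇒ D} →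
                              IsPullback p₁ p₂ f g → IsWeakPullback p₁ p₂ f g
  IsPullback⇒IsWeakPullback pb = record
    { commute = commute
    ; factor  = λ h₁ h₂ sq → universal h₁ h₂ sq , p₁∘universal , p₂∘universal
    }
    where open IsPullback pb

  AMSpan-∘ : PreservesWeakPullbacks F →
             ∀ {α β γ R S P} {a : R ⇒ carrier α} {b : R ⇒ carrier β}
             {b′ : S ⇒ carrier β} {c : S ⇒ carrier γ} {μ₁ : P ⇒ R} {μ₂ : P ⇒ S} →
             IsPullback μ₁ μ₂ b b′ →
             AMSpan α β a b → AMSpan β γ b′ c → AMSpan α γ (a ∘ μ₁) (c ∘ μ₂)
  AMSpan-∘ preserves {α} {β} {γ} {R} {S} {P} {a} {b} {b′} {c} {μ₁} {μ₂} pb s t =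
    record { cover = k ; w = v ; lower = lower′ ; upper = upper′ }
    where
    module s = AMSpan s
    module t = AMSpan t
    fst = pull-cover (Cover.isEpi s.cover) μ₁
    snd = pull-cover (Cover.isEpi t.cover) (μ₂ ∘ map (proj₁ fst))
    c₁ = proj₁ fst
    c₂ = proj₁ snd
    -- A common cover of `P`, from which `z₁` and `z₂` lead to the covers of the two given spans.
    k = c₁ ∘ᶜ c₂
    z₁ = proj₁ (proj₂ fst) ∘ map c₂
    z₂ = proj₁ (proj₂ snd)

    z₁-eq : map s.cover ∘ z₁ ≈ μ₁ ∘ map k
    z₁-eq = trans (pull (proj₂ (proj₂ fst))) assoc

    z₂-eq : map t.cover ∘ z₂ ≈ μ₂ ∘ map k
    z₂-eq = trans (proj₂ (proj₂ snd)) assoc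

    w₁ = s.w ∘ z₁

    slide : ∀ {A D Q U} {f : A ⇒ D} {h : Q ⇒ A} {x : U ⇒ Q} {z : src k ⇒ U} {μ : P ⇒ Q} →
            x ∘ z ≈ μ ∘ map k → ((f ∘ h) ∘ x) ∘ z ≈ (f ∘ (h ∘ μ)) ∘ map k
    slide eq = trans assoc (trans (∘-congˡ eq)
      (trans (sym assoc) (∘-congʳ assoc)))

    -- The two spans meet at the structure map of `β`, applied to the middle leg `b ∘ μ₁ ≈ b′ ∘ μ₂`.
    Fb∘w₁≤ : _≤_ {src k} {carrier β} (F₁ b ∘ w₁) (F₁ b′ ∘ (t.w ∘ z₂))
    Fb∘w₁≤ = ≤.trans (≤-resp assoc (slide z₁-eq) (≤-∘ z₁ s.upper))
      (≤-resp (trans (slide z₂-eq) (∘-congʳ (∘-congˡ (sym (IsPullback.commute pb))))) assoc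
        (≤-∘ z₂ t.lower))

    -- `t.w ∘ z₂` is lowered to `w₂`, which turns the inequality into the equality that a square
    -- over `F₁ b` and `F₁ b′` demands.
    lifted = ≤-lift _ _ b′ Fb∘w₁≤
    w₂ = proj₁ lifted

    -- `F` of the pullback is a weak pullback, so `w₁` and `w₂` both come from one `v` into `F₀ P`.
    amalgam = IsWeakPullback.factor (preserves (IsPullback⇒IsWeakPullback pb)) w₁ w₂ (proj₂ (proj₂ lifted))
    v = proj₁ amalgam

    lower′ : _≤_ {src k} {carrier α} ((structure α ∘ (a ∘ μ₁)) ∘ map k) (F₁ (a ∘ μ₁) ∘ v)
    lower′ = ≤-resp (slide z₁-eq) (begin
      (F₁ a ∘ s.w) ∘ z₁     ≈⟨ assoc ⟩
      F₁ a ∘ w₁             ≈⟨ ∘-congˡ (proj₁ (proj₂ amalgam)) ⟨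
      F₁ a ∘ (F₁ μ₁ ∘ v)    ≈⟨ pull (sym homomorphism) ⟩
      F₁ (a ∘ μ₁) ∘ v       ∎) (≤-∘ z₁ s.lower)

    upper′ : _≤_ {src k} {carrier γ} (F₁ (c ∘ μ₂) ∘ v) ((structure γ ∘ (c ∘ μ₂)) ∘ map k)
    upper′ = ≤-resp (begin
      F₁ c ∘ w₂             ≈⟨ ∘-congˡ (proj₂ (proj₂ amalgam)) ⟨
      F₁ c ∘ (F₁ μ₂ ∘ v)    ≈⟨ pull (sym homomorphism) ⟩
      F₁ (c ∘ μ₂) ∘ v       ∎) refl
      -- `F₁ μ₂ ∘ v` is `w₂`, which is only below `t.w ∘ z₂`; monotonicity of `F₁ c ∘_` bridges the
      -- gap.
      (≤.trans (F∘-≤ c (proj₁ (proj₂ lifted)))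
        (≤-resp assoc (slide z₂-eq) (≤-∘ z₂ t.upper)))

  -- The two simulation inequalities read on elements.

  module _ {V R A Y} {h : V ⇒ F₀ Y} {W : V ⇒ 𝒫 (F₀ R)} {f : A ⇒ Y} {g : R ⇒ A} where
    private
      𝒫FfgW : V ⇒ 𝒫 (F₀ Y)
      𝒫FfgW = 𝒫₁ (F₁ f) ∘ 𝒫₁ (F₁ g) ∘ W

      F∘ : ∀ {U} {w : U ⇒ F₀ R} → F₁ f ∘ F₁ g ∘ w ≈ F₁ (f ∘ g) ∘ w
      F∘ = pull (sym homomorphism)

      𝒫₁²-intro : ∀ {U} {w : U ⇒ F₀ R} {x : U ⇒ V} → w ∈∈ W ∘ x → F₁ (f ∘ g) ∘ w ∈∈ 𝒫FfgW ∘ x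
      𝒫₁²-intro w∈ = ∈∈-resp F∘ (sym (trans assoc (∘-congˡ assoc))) (𝒫₁-intro (𝒫₁-intro w∈))

      𝒫₁²-elim : ∀ {U} {y : U ⇒ F₀ Y} {x : U ⇒ V} → y ∈∈ 𝒫FfgW ∘ x →
                 Σ[ c ∈ Cover U ] Σ[ w ∈ src c ⇒ F₀ R ]
                   (w ∈∈ W ∘ (x ∘ map c)) ∧ (F₁ (f ∘ g) ∘ w ≈ y ∘ map c)
      𝒫₁²-elim {y = y} y∈ =
        let c , u , u∈ , u-eq = 𝒫₁-elim (∈∈-resp refl (trans assoc (∘-congˡ assoc)) y∈)
            d , w , w∈ , w-eq = 𝒫₁-elim (∈∈-resp refl assoc u∈)
        in c ∘ᶜ d , w , ∈∈-resp refl (trans assoc assoc) w∈ , (begin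
             F₁ (f ∘ g) ∘ w          ≈⟨ F∘ ⟨
             F₁ f ∘ F₁ g ∘ w         ≈⟨ ∘-congˡ w-eq ⟩
             F₁ f ∘ u ∘ map d        ≈⟨ pull u-eq ⟩
             (y ∘ map c) ∘ map d     ≈⟨ assoc ⟩
             y ∘ map c ∘ map d       ∎)

    -- The order is tested on `h`, the element of the singleton at the identity stage; its bound
    -- lies in the direct image and so comes, on a further cover, from an element of `W`.
    η≤𝒫-elim : _≤𝒫_ {V} {Y} (η (F₀ Y) ∘ h) 𝒫FfgW →
               Σ[ c ∈ Cover V ] Σ[ w ∈ src c ⇒ F₀ R ]
                 _≤_ {src c} {Y} (h ∘ map c) (F₁ (f ∘ g) ∘ w) ∧ (w ∈∈ W ∘ map c)
    η≤𝒫-elim le =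
      let c , t , h≤t , t∈ = ≤𝒫-elim {Y = Y} le {t = h} {x = id} (∈∈-resp refl (sym identityʳ) η-intro)
          d , w , w∈ , w-eq = 𝒫₁²-elim t∈
      in c ∘ᶜ d , w , ≤-resp assoc (sym w-eq) (≤-∘ (map d) h≤t)
         , ∈∈-resp refl (∘-congˡ (trans assoc identityˡ)) w∈

    -- Every element of the singleton at stage `x` equals `h ∘ x`, so one local witness, pulled back
    -- along `x`, bounds them all.
    η≤𝒫-intro : (c : Cover V) (w : src c ⇒ F₀ R) →
                _≤_ {src c} {Y} (h ∘ map c) (F₁ (f ∘ g) ∘ w) → w ∈∈ W ∘ map c →
                _≤𝒫_ {V} {Y} (η (F₀ Y) ∘ h) 𝒫FfgW
    η≤𝒫-intro c w le w∈ = ≤𝒫-intro λ {_} {t} {x} t∈ →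
      let d , z , sq = pull-cover (Cover.isEpi c) x
      in d , F₁ (f ∘ g) ∘ w ∘ z
         , ≤-resp (begin
               (h ∘ map c) ∘ z   ≈⟨ trans assoc (∘-congˡ sq) ⟩
               h ∘ x ∘ map d     ≈⟨ pull (sym (η-elim (∈∈-resp refl assoc t∈))) ⟩
               t ∘ map d         ∎)
             assoc (≤-∘ z le)
         , 𝒫₁²-intro (∈∈-resp refl (trans assoc (∘-congˡ sq)) (⊲-⟨⟩∘ z w∈))

    𝒫≤η-elim : _≤𝒫_ {V} {Y} 𝒫FfgW (η (F₀ Y) ∘ h) →
               ∀ {U} {w : U ⇒ F₀ R} {x : U ⇒ V} → w ∈∈ W ∘ x →
               Σ[ c ∈ Cover U ]
                 _≤_ {src c} {Y} (F₁ (f ∘ g) ∘ (w ∘ map c)) (h ∘ (x ∘ map c))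
    𝒫≤η-elim le w∈ =
      let c , t , w≤t , t∈ = ≤𝒫-elim le (𝒫₁²-intro w∈)
      in c , ≤-resp assoc (η-elim (∈∈-resp refl assoc t∈)) w≤t

    -- Each element of the direct image comes, on a cover, from some `w` in `W`, to which the
    -- hypothesis applies.
    𝒫≤η-intro : (∀ {U} {w : U ⇒ F₀ R} {x : U ⇒ V} → w ∈∈ W ∘ x →
                  Σ[ c ∈ Cover U ]
                    _≤_ {src c} {Y} (F₁ (f ∘ g) ∘ (w ∘ map c)) (h ∘ (x ∘ map c))) →
                _≤𝒫_ {V} {Y} 𝒫FfgW (η (F₀ Y) ∘ h)
    𝒫≤η-intro below = ≤𝒫-intro λ {_} {t} {x} t∈ →
      let c , w , w∈ , w-eq = 𝒫₁²-elim t∈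
          d , le = below w∈
      in c ∘ᶜ d , h ∘ ((x ∘ map c) ∘ map d)
         , ≤-resp (trans (pull w-eq) assoc) refl le
         , ∈∈-resp refl (trans (∘-congˡ (∘-congˡ assoc)) (sym assoc)) η-intro

  -- Simulations as spans, and their closure under identities and composition.

  simulation⇒AMSpan : ∀ {α β} (r : Relation (carrier α) (carrier β)) →
                      IsToposalAMSimulation α β r → AMSpan α β (π₁ ∘ arr r) (π₂ ∘ arr r)
  simulation⇒AMSpan r sim =
    let W , le₁ , le₂ = sim r (≅-refl {r = r})
        c , w , lower , w∈ = η≤𝒫-elim le₁
        -- The second inequality speaks of every element of `W`, hence of the `w` chosen from the
        -- first; one witness serves both.
        d , upper = 𝒫≤η-elim le₂ w∈
    in record
      { cover = c ∘ᶜ d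
      ; w     = w ∘ map d
      ; lower = ≤-resp assoc assoc (≤-∘ (map d) lower)
      ; upper = upper
      }

  AMSpan⇒simulation : ∀ {α β} (r : Relation (carrier α) (carrier β)) →
                      AMSpan α β (π₁ ∘ arr r) (π₂ ∘ arr r) → IsToposalAMSimulation α β r
  AMSpan⇒simulation {α} {β} r s ρ ρ≅r =
    W
    , η≤𝒫-intro cover w lower (∈ξ.from image-intro)
    , 𝒫≤η-intro λ v∈ →
        let c , z , eq = image-elim (∈ξ.to v∈)
            wz = trans (sym ⟨⟩∘) (trans eq ⟨⟩∘)
        in c , ≤-resp
             (trans assoc (∘-congˡ (⟨⟩-inj₁ wz)))
             (trans assoc (∘-congˡ (⟨⟩-inj₂ wz)))
             (≤-∘ z upper)
    where
    open _≅_ ρ≅r using (from; from∘to)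

    leg : ∀ {A} {π : _ ⇒ A} → (π ∘ arr ρ) ∘ from ≈ π ∘ arr r
    leg = trans assoc (∘-congˡ (proj₂ (≅⇒⊒ ρ≅r)))

    ρ-span : AMSpan α β (π₁ ∘ arr ρ) (π₂ ∘ arr ρ)
    -- The definition ranges over all representatives; `from` is a split epi, so the span on `dom r`
    -- moves to `dom ρ`.
    ρ-span = AMSpan-image {q = from} (section-epi from∘to) leg leg s

    open AMSpan ρ-span

    -- The image is taken because the pairing may fail to be mono. The elements of `W` over `x` are
    -- thus, locally, the values of `w` at points of the cover above `x`.
    W : dom ρ ⇒ 𝒫 (F₀ (dom ρ))
    W = ξ im⟨ ⟨ w , map cover ⟩ ⟩ (im⟨⟩-mono ⟨ w , map cover ⟩)

  idRel-simulation : (α : Coalgebra F) → IsToposalAMSimulation α α (idRel (carrier α))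
  idRel-simulation α = AMSpan⇒simulation (idRel (carrier α))
    (AMSpan-image {q = id} id-epi (trans identityʳ project₁) (trans identityʳ project₂) (AMSpan-id α))

  -- Spans are composed on the pullback; the epi part of the factorisation then carries the result
  -- to the mono representing `r ⨾ s`.
  ⨾-simulation : PreservesWeakPullbacks F →
                 ∀ {α β γ} (r : Relation (carrier α) (carrier β)) (s : Relation (carrier β) (carrier γ)) →
                 IsToposalAMSimulation α β r → IsToposalAMSimulation β γ s →
                 IsToposalAMSimulation α γ (r ⨾ s)
  ⨾-simulation preserves r s r-sim s-sim = AMSpan⇒simulation (r ⨾ s)
    (AMSpan-image im.isEpi (leg (trans project₁ (sym assoc))) (leg (trans project₂ (sym assoc)))
      (AMSpan-∘ preserves pb.isPullback (simulation⇒AMSpan r r-sim) (simulation⇒AMSpan s s-sim)))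
    where
    module pb = Pullback (pullback (π₂ ∘ arr r) (π₁ ∘ arr s))
    span = ⟨ π₁ ∘ arr r ∘ pb.p₁ , π₂ ∘ arr s ∘ pb.p₂ ⟩
    module im = EpiMonoFactorisation (image span)

    leg : ∀ {A B} {π : _ ⇒ A} {f : B ⇒ A} {g : _ ⇒ B} → π ∘ span ≈ f ∘ g →
          (π ∘ im.mono) ∘ im.epi ≈ f ∘ g
    leg eq = trans assoc (trans (∘-congˡ im.commute) eq)

proposition5p19 : ∀ {o ℓ e p} (T : Topos o ℓ e) (F : Endofunctor (Topos.category T)) →
    PreservesWeakPullbacks F →
    (order : GoodOrderStructure F p) →
    let open ToposDefs T
        open Simulation T F order
        open Coalgebra
    in
    Σ[ id-sim ∈ (∀ (α : Coalgebra F) → IsToposalAMSimulation α α (idRel (carrier α))) ]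
    Σ[ ⨾-sim ∈ (∀ {α β γ : Coalgebra F}
                  (r : Relation (carrier α) (carrier β)) (s : Relation (carrier β) (carrier γ)) →
                  IsToposalAMSimulation α β r → IsToposalAMSimulation β γ s →
                  IsToposalAMSimulation α γ (r ⨾ s)) ]
    IsLocallyOrdered2Category {Obj = Coalgebra F} AMSimulation
      (λ r s → proj₁ r ≅ proj₁ s)
      (λ r s → proj₁ r ⊑ proj₁ s)
      (λ α → idRel (carrier α) , id-sim α)
      (λ {α} {β} {γ} r s → (proj₁ r ⨾ proj₁ s) , ⨾-sim {α} {β} {γ} (proj₁ r) (proj₁ s) (proj₂ r) (proj₂ s))
proposition5p19 T F preserves order =
  idRel-simulation ,
  (λ {α} {β} {γ} r s → ⨾-simulation preserves {α} {β} {γ} r s) ,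
  -- Equality and order of morphisms compare only the underlying relations, so every law is
  -- inherited from relations.
  record
    { isPartialOrder = record
        { isPreorder = record
            { isEquivalence = record
                { refl  = λ {r} → ≅-refl {r = proj₁ r}
                ; sym   = λ {r} {s} i → ⊑-antisym {r = proj₁ s} {proj₁ r} (≅⇒⊒ i) (≅⇒⊑ i)
                ; trans = λ {r} {s} {t} i j → ⊑-antisym {r = proj₁ r} {proj₁ t}
                    (⊲-trans (≅⇒⊑ i) (≅⇒⊑ j)) (⊲-trans (≅⇒⊒ j) (≅⇒⊒ i))
                }
            ; reflexive = ≅⇒⊑
            ; trans     = ⊲-trans
            }
        ; antisym = λ {r} {s} → ⊑-antisym {r = proj₁ r} {proj₁ s}
        }
    ; ⨾-mono    = λ {_} {_} {_} {r} {r′} {s} {s′} →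
        ⨾-mono (proj₁ r) (proj₁ r′) (proj₁ s) (proj₁ s′)
    ; assoc     = λ r s t → ⨾-assoc (proj₁ r) (proj₁ s) (proj₁ t)
    ; identityˡ = λ r → ⨾-identityˡ (proj₁ r)
    ; identityʳ = λ r → ⨾-identityʳ (proj₁ r)
    }
  where
  open GeneralisedElements T using (⊲-trans)
  open Relations T
  open Simulations T F order
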